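{- Let $W$ be a finite Coxeter group, $c$ a standard Coxeter element, and $\vec\pi\in\mathsf{MC}(W,c)$. Then the set $\{u\in W_c^+: u\text{ and }\vec\pi\text{ are concordant}\}$ is a nonempty interval in the left weak order; that is, there exist $\omega_\downarrow(\vec\pi),\omega^\uparrow(\vec\pi)\in W$ such that this set equals $[\omega_\downarrow(\vec\pi),\omega^\uparrow(\vec\pi)]_L\neq\emptyset$.
   Context: $W$ is a finite Coxeter group of rank $r$ with simple reflections $S$ and reflections $T$; $\ell_S,\ell_T$ are lengths with respect to $S,T$. Bruhat order $\leq_{\mathrm B}$: covers $u\lessdot_{\mathrm B}v$ iff $v=ut$, $t\in T$, $\ell_S(v)=\ell_S(u)+1$. Absolute order: $u\leq_T v$ iff $\ell_T(u)+\ell_T(u^{ -1}v)=\ell_T(v)$. A standard Coxeter element $c$ is a product of all elements of $S$ each once in some order. $W_c^+=\{u\in W:\ell_S(uc)=\ell_S(u)+r\}$. $\mathsf{MC}(W,c)$ is the set of maximal chains $\vec\pi=\{e=\pi_0\lessdot_T\pi_1\lessdot_T\cdots\lessdot_T\pi_r=c\}$ of the interval $[e,c]_T$. $u\in W_c^+$ and $\vec\pi$ are concordant if $u\pi_0\leq_{\mathrm B}u\pi_1\leq_{\mathrm B}\cdots\leq_{\mathrm B}u\pi_r$. Left weak order: $u\leq_L v$ iff some reduced $S$-word for $v$ has a reduced $S$-word for $u$ as a suffix; $[x,y]_L$ denotes an interval in it. -}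

module Defs where

open import Level using (Level; _⊔_; suc)
open import Data.Nat using (ℕ; zero; _+_; _≤_) renaming (suc to sucℕ)
open import Data.Fin using (Fin; inject₁) renaming (suc to fsuc; zero to fzero)
open import Data.List using (List; []; _∷_; foldr; map; length; allFin; _++_)
open import Data.List.Relation.Unary.All using (All)
open import Data.List.Relation.Unary.Any using (Any)
open import Data.List.Relation.Binary.Permutation.Propositional using (_↭_)
open import Data.Product using (Σ; ∃; ∃-syntax; _×_; _,_)
open import Data.Sum using (_⊎_)
open import Relation.Binary.PropositionalEquality using (_≡_; _≢_)
open import Relation.Binary.Construct.Closure.Transitive using (Plus)
open import Relation.Nullary using (¬_)
open import Algebra.Bundles using (Group)
open import Algebra.Morphism.Structures using (module GroupMorphisms)

module _ {c ℓ : Level} (G : Group c ℓ) where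
  open Group G
  pow : Carrier → ℕ → Carrier
  pow x zero = ε
  pow x (sucℕ n) = x ∙ pow x n

record CoxeterMatrix (r : ℕ) : Set where
  field
    m     : Fin r → Fin r → ℕ
    diag  : ∀ i → m i i ≡ 1
    symm  : ∀ i j → m i j ≡ m j i
    off   : ∀ i j → i ≢ j → 2 ≤ m i j

-- (G, s) is a Coxeter system with Coxeter matrix M: s generates G, the
-- Coxeter relations hold, and G has the universal property of the group
-- presentation < s_i | (s_i s_j)^{m_ij} = e > (w.r.t. groups of the same level).
module _ {c ℓ : Level} (G : Group c ℓ) {r : ℕ} (s : Fin r → Group.Carrier G) where
  open Group G

  evalS : List (Fin r) → Carrier
  evalS w = foldr _∙_ ε (map s w)

  record IsCoxeterSystem (M : CoxeterMatrix r) : Set (suc (c ⊔ ℓ)) where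
    open CoxeterMatrix M
    field
      generates : ∀ w → ∃[ ws ] evalS ws ≈ w
      relations : ∀ i j → pow G (s i ∙ s j) (m i j) ≈ ε
      universal : (H : Group c ℓ) (f : Fin r → Group.Carrier H) →
        (∀ i j → Group._≈_ H (pow H (Group._∙_ H (f i) (f j)) (m i j)) (Group.ε H)) →
        Σ (Carrier → Group.Carrier H) λ φ →
          GroupMorphisms.IsGroupHomomorphism rawGroup (Group.rawGroup H) φ
          × (∀ i → Group._≈_ H (φ (s i)) (f i))
      unique : (H : Group c ℓ) (φ ψ : Carrier → Group.Carrier H) →
        GroupMorphisms.IsGroupHomomorphism rawGroup (Group.rawGroup H) φ →
        GroupMorphisms.IsGroupHomomorphism rawGroup (Group.rawGroup H) ψ →
        (∀ i → Group._≈_ H (φ (s i)) (ψ (s i))) →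
        ∀ w → Group._≈_ H (φ w) (ψ w)

  IsFinite : Set (c ⊔ ℓ)
  IsFinite = ∃[ xs ] (∀ w → Any (w ≈_) xs)

  HasLenS : Carrier → ℕ → Set ℓ
  HasLenS w n = (∃[ ws ] (length ws ≡ n × evalS ws ≈ w))
              × (∀ ws → evalS ws ≈ w → n ≤ length ws)

  IsReflection : Carrier → Set (c ⊔ ℓ)
  IsReflection t = ∃[ w ] ∃[ i ] (t ≈ (w ∙ s i) ∙ w ⁻¹)

  prod : List Carrier → Carrier
  prod = foldr _∙_ ε

  HasLenT : Carrier → ℕ → Set (c ⊔ ℓ)
  HasLenT w n = (∃[ ts ] (All IsReflection ts × length ts ≡ n × prod ts ≈ w))
              × (∀ ts → All IsReflection ts → prod ts ≈ w → n ≤ length ts)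

  _≤T_ : Carrier → Carrier → Set (c ⊔ ℓ)
  u ≤T v = ∃[ a ] ∃[ b ] (HasLenT u a × HasLenT (u ⁻¹ ∙ v) b × HasLenT v (a + b))

  _⋖T_ : Carrier → Carrier → Set (c ⊔ ℓ)
  u ⋖T v = u ≤T v × ¬ (u ≈ v) × (∀ w → u ≤T w → w ≤T v → w ≈ u ⊎ w ≈ v)

  BruhatCover : Carrier → Carrier → Set (c ⊔ ℓ)
  BruhatCover u v = ∃[ t ] (IsReflection t × v ≈ u ∙ t
                      × ∃[ n ] (HasLenS u n × HasLenS v (sucℕ n)))

  _≤B_ : Carrier → Carrier → Set (c ⊔ ℓ)
  u ≤B v = u ≈ v ⊎ Plus BruhatCover u v

  IsStdCoxeterElement : Carrier → Set ℓ
  IsStdCoxeterElement x = ∃[ ws ] (ws ↭ allFin r × evalS ws ≈ x)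

  InWcPlus : Carrier → Carrier → Set ℓ
  InWcPlus x u = ∃[ n ] (HasLenS u n × HasLenS (u ∙ x) (n + r))

  IsMaxChain : Carrier → (Fin (sucℕ r) → Carrier) → Set (c ⊔ ℓ)
  IsMaxChain x π = π fzero ≈ ε × π (Data.Fin.fromℕ r) ≈ x
                 × (∀ (i : Fin r) → π (inject₁ i) ⋖T π (fsuc i))

  Concordant : Carrier → (Fin (sucℕ r) → Carrier) → Set (c ⊔ ℓ)
  Concordant u π = ∀ (i : Fin r) → (u ∙ π (inject₁ i)) ≤B (u ∙ π (fsuc i))

  Reduced : List (Fin r) → Set ℓ
  Reduced ws = HasLenS (evalS ws) (length ws)

  _≤L_ : Carrier → Carrier → Set ℓ
  u ≤L v = ∃[ as ] ∃[ bs ] (Reduced bs × Reduced (as ++ bs)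
                             × evalS bs ≈ u × evalS (as ++ bs) ≈ v)

{-# OPTIONS --safe #-}

-- Write t_i = π_{i-1}⁻¹ π_i and ρ_i = π_{i-1} t_i π_{i-1}⁻¹; these are reflections.  Since c has
-- length at most r, an element u is a concordant member of W_c⁺ iff the lengths of the u π_i
-- strictly increase, and by the cocycle property of inversion sets this prescribes, for each i,
-- whether ρ_i is a right inversion of u.  Such a set of elements is convex and gallery-connected
-- for the left weak order.  It is also closed under local joins: if u, s u, s' u belong to it and
-- the latter two lie above u, then s and s' are left ascents of every u π_i, because
-- ℓ(s u π_i) = ℓ(s u) + i; hence ℓ(w u π_i) = ℓ(w) + ℓ(u π_i) for all w in ⟨s, s'⟩ and w u belongs
-- to the set.  Newman's lemma then gives a unique maximal element, and multiplying by the longest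
-- element gives the minimum.
--
-- For nonemptiness, ρ_1, …, ρ_k lie in a parabolic subgroup of rank at most k.  If ρ_{k+1} is
-- outside it, its status can be chosen independently of that of ρ_1, …, ρ_k, by multiplying with
-- w₀ w₀(J); so all sign patterns occur unless c lies in a proper parabolic subgroup.  The latter
-- is impossible: following the minimal coset representatives along a word for c, which uses every
-- simple reflection once, either writes c with fewer than r reflections or shows that W is
-- generated by fewer than r simple reflections, in which case two letters of c are equal and
-- cancel up to conjugation; but c has absolute length r.
module Submission where

open import Defs
open import Level using (Level; Lift; lift; lower)
open import Data.Nat using (ℕ; zero; _+_; _≤_; _<_; z≤n; s≤s; s≤s⁻¹) renaming (suc to sucℕ)
import Data.Nat.Properties as ℕ
open import Data.Bool using (Bool; true; false; not; _xor_)
import Data.Bool.Properties as Bool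
open import Data.Fin using (Fin; inject₁; fromℕ; toℕ; punchIn; punchOut) renaming (zero to fzero; suc to fsuc)
import Data.Fin as Fin
import Data.Fin.Properties as Fin
open import Data.Fin.Induction using (<-weakInduction; >-weakInduction)
open import Data.List using (List; []; _∷_; foldr; _++_; length; reverse; map)
import Data.List as List
import Data.List.Properties as List
open import Data.List.Relation.Unary.All using (All; []; _∷_)
import Data.List.Relation.Unary.All as All
import Data.List.Relation.Unary.All.Properties as All
open import Data.List.Relation.Unary.Any using (here; there)
import Data.List.Relation.Unary.Any as Any
import Data.List.Relation.Unary.Any.Properties as Any
open import Data.List.Membership.Propositional using (_∈_)
open import Data.List.Membership.Propositional.Properties using (∈-allFin)
import Data.List.Relation.Binary.Permutation.Propositional as ↭
import Data.List.Relation.Binary.Permutation.Propositional.Properties as ↭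
open import Data.Unit using (⊤; tt)
open import Data.Vec using (Vec; []; _∷_; lookup)
open import Data.Product using (Σ-syntax; ∃-syntax; _×_; _,_; proj₁; proj₂)
import Data.Product.Properties as Product
open import Data.Sum using (_⊎_; inj₁; inj₂)
import Data.Sum.Properties as Sum
open import Relation.Binary.PropositionalEquality using (_≡_; _≢_; refl; cong; cong₂; subst)
import Relation.Binary.PropositionalEquality as ≡
open import Relation.Binary.Construct.Closure.Transitive using (Plus; [_]; _∼⁺⟨_⟩_)
import Relation.Binary.Reasoning.Setoid
open import Relation.Nullary using (Dec; yes; no; does; ¬_; contradiction)
open import Relation.Nullary.Decidable using (map′; ¬?; _×-dec_; _⊎-dec_; decidable-stable; does-⇔)
open import Function using (_∘_)
open import Function.Bundles using (_⇔_; mk⇔; module Equivalence)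
open import Algebra.Bundles using (Group)
open import Algebra.Morphism.Structures using (module GroupMorphisms)
import Algebra.Properties.Group

-- A decision procedure for equations in a group, modulo squares of designated involutions.
module GroupSolver {a ℓ : Level} (G : Group a ℓ) where
  open Group G renaming (refl to ≈-refl; sym to ≈-sym; trans to ≈-trans)
  open Algebra.Properties.Group G using (ε⁻¹≈ε; ⁻¹-involutive; ⁻¹-anti-homo-∙; inverseʳ-unique)
  open Relation.Binary.Reasoning.Setoid setoid

  Involution : Set _
  Involution = Σ[ x ∈ Carrier ] x ∙ x ≈ ε

  infixl 7 _⊙_
  infix  8 _⁻

  data Expr (n k : ℕ) : Set where
    var : Fin n → Expr n k
    ivar : Fin k → Expr n k
    ι : Expr n k
    _⊙_ : Expr n k → Expr n k → Expr n k
    _⁻ : Expr n k → Expr n k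

  x₀ : ∀ {n k} → Expr (sucℕ n) k
  x₀ = var fzero
  x₁ : ∀ {n k} → Expr (sucℕ (sucℕ n)) k
  x₁ = var (fsuc fzero)
  x₂ : ∀ {n k} → Expr (sucℕ (sucℕ (sucℕ n))) k
  x₂ = var (fsuc (fsuc fzero))
  x₃ : ∀ {n k} → Expr (sucℕ (sucℕ (sucℕ (sucℕ n)))) k
  x₃ = var (fsuc (fsuc (fsuc fzero)))
  τ₀ : ∀ {n k} → Expr n (sucℕ k)
  τ₀ = ivar fzero
  τ₁ : ∀ {n k} → Expr n (sucℕ (sucℕ k))
  τ₁ = ivar (fsuc fzero)

  -- The Boolean is `true` for a variable and `false` for its inverse; involutions are their own
  -- inverses and carry no sign.
  Letter : ℕ → ℕ → Set
  Letter n k = (Bool × Fin n) ⊎ Fin k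

  flip : ∀ {n k} → Letter n k → Letter n k
  flip (inj₁ (b , i)) = inj₁ (not b , i)
  flip (inj₂ i) = inj₂ i

  _≟L_ : ∀ {n k} (x y : Letter n k) → Dec (x ≡ y)
  _≟L_ = Sum.≡-dec (Product.≡-dec Bool._≟_ Fin._≟_) Fin._≟_

  push : ∀ {n k} → Letter n k → List (Letter n k) → List (Letter n k)
  push x [] = x ∷ []
  push x (y ∷ ys) with x ≟L flip y
  ... | yes _ = ys
  ... | no _ = x ∷ y ∷ ys

  append : ∀ {n k} → List (Letter n k) → List (Letter n k) → List (Letter n k)
  append xs ys = foldr push ys xs

  invert : ∀ {n k} → List (Letter n k) → List (Letter n k)
  invert [] = []
  invert (x ∷ xs) = append (invert xs) (flip x ∷ [])

  normalise : ∀ {n k} → Expr n k → List (Letter n k)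
  normalise (var i) = inj₁ (true , i) ∷ []
  normalise (ivar i) = inj₂ i ∷ []
  normalise ι = []
  normalise (e ⊙ f) = append (normalise e) (normalise f)
  normalise (e ⁻) = invert (normalise e)

  module _ {n k : ℕ} (ρ : Vec Carrier n) (ς : Vec Involution k) where
    ⟦_⟧ : Expr n k → Carrier
    ⟦ var i ⟧ = lookup ρ i
    ⟦ ivar i ⟧ = proj₁ (lookup ς i)
    ⟦ ι ⟧ = ε
    ⟦ e ⊙ f ⟧ = ⟦ e ⟧ ∙ ⟦ f ⟧
    ⟦ e ⁻ ⟧ = ⟦ e ⟧ ⁻¹

    letter : Letter n k → Carrier
    letter (inj₁ (true , i)) = lookup ρ i
    letter (inj₁ (false , i)) = lookup ρ i ⁻¹
    letter (inj₂ i) = proj₁ (lookup ς i)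

    word : List (Letter n k) → Carrier
    word [] = ε
    word (x ∷ xs) = letter x ∙ word xs

    letter-flip : ∀ x → letter (flip x) ≈ letter x ⁻¹
    letter-flip (inj₁ (true , i)) = ≈-refl
    letter-flip (inj₁ (false , i)) = ≈-sym (⁻¹-involutive _)
    letter-flip (inj₂ i) = inverseʳ-unique _ _ (proj₂ (lookup ς i))

    word-push : ∀ x xs → word (push x xs) ≈ letter x ∙ word xs
    word-push x [] = ≈-refl
    word-push x (y ∷ ys) with x ≟L flip y
    ... | no _ = ≈-refl
    ... | yes refl = ≈-sym (begin
      letter (flip y) ∙ (letter y ∙ word ys) ≈⟨ assoc _ _ _ ⟨
      letter (flip y) ∙ letter y ∙ word ys   ≈⟨ ∙-congʳ (∙-congʳ (letter-flip y)) ⟩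
      letter y ⁻¹ ∙ letter y ∙ word ys       ≈⟨ ∙-congʳ (inverseˡ _) ⟩
      ε ∙ word ys                            ≈⟨ identityˡ _ ⟩
      word ys                                ∎)

    word-append : ∀ xs ys → word (append xs ys) ≈ word xs ∙ word ys
    word-append [] ys = ≈-sym (identityˡ _)
    word-append (x ∷ xs) ys = begin
      word (push x (append xs ys))    ≈⟨ word-push x (append xs ys) ⟩
      letter x ∙ word (append xs ys)  ≈⟨ ∙-congˡ (word-append xs ys) ⟩
      letter x ∙ (word xs ∙ word ys)  ≈⟨ assoc _ _ _ ⟨
      letter x ∙ word xs ∙ word ys    ∎

    word-invert : ∀ xs → word (invert xs) ≈ word xs ⁻¹
    word-invert [] = ≈-sym ε⁻¹≈ε
    word-invert (x ∷ xs) = begin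
      word (append (invert xs) (flip x ∷ []))  ≈⟨ word-append (invert xs) _ ⟩
      word (invert xs) ∙ (letter (flip x) ∙ ε) ≈⟨ ∙-cong (word-invert xs) (≈-trans (identityʳ _) (letter-flip x)) ⟩
      word xs ⁻¹ ∙ letter x ⁻¹                 ≈⟨ ⁻¹-anti-homo-∙ _ _ ⟨
      (letter x ∙ word xs) ⁻¹                  ∎

    sound : ∀ e → word (normalise e) ≈ ⟦ e ⟧
    sound (var i) = identityʳ _
    sound (ivar i) = identityʳ _
    sound ι = ≈-refl
    sound (e ⊙ f) = ≈-trans (word-append (normalise e) _) (∙-cong (sound e) (sound f))
    sound (e ⁻) = ≈-trans (word-invert (normalise e)) (⁻¹-cong (sound e))

    -- Callers pass `refl`: on closed expressions both reduced words compute, so type checking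
    -- decides the equation.
    solve : ∀ e f → normalise e ≡ normalise f → ⟦ e ⟧ ≈ ⟦ f ⟧
    solve e f eq = begin
      ⟦ e ⟧              ≈⟨ sound e ⟨
      word (normalise e) ≡⟨ cong word eq ⟩
      word (normalise f) ≈⟨ sound f ⟩
      ⟦ f ⟧              ∎

-- Permutation groups as targets of the universal property.

record Perm (A : Set) : Set where
  field
    to from : A → A
    to-from : ∀ x → to (from x) ≡ x
    from-to : ∀ x → from (to x) ≡ x

-- The universal property quantifies over groups at the levels of `W`, so carrier and equality are
-- lifted to them.
permutationGroup : ∀ a ℓ → Set → Group a ℓ
permutationGroup a ℓ A = record
  { Carrier = Lift a (Perm A)
  ; _≈_ = λ f g → Lift ℓ (∀ x → to (lower f) x ≡ to (lower g) x)
  ; _∙_ = λ f g → lift (compose (lower f) (lower g))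
  ; ε = lift (record { to = λ x → x ; from = λ x → x ; to-from = λ _ → refl ; from-to = λ _ → refl })
  ; _⁻¹ = λ f → lift (inverse (lower f))
  ; isGroup = record
    { isMonoid = record
      { isSemigroup = record
        { isMagma = record
          { isEquivalence = record
            { refl = lift λ _ → refl
            ; sym = λ p → lift λ x → ≡.sym (lower p x)
            ; trans = λ p q → lift λ x → ≡.trans (lower p x) (lower q x) }
          ; ∙-cong = λ {f} {g} {h} {k} p q →
              lift λ x → ≡.trans (lower p _) (cong (to (lower g)) (lower q x)) }
        ; assoc = λ _ _ _ → lift λ _ → refl }
      ; identity = (λ _ → lift λ _ → refl) , (λ _ → lift λ _ → refl) }
    ; inverse = (λ f → lift (from-to (lower f))) , (λ f → lift (to-from (lower f)))
    ; ⁻¹-cong = λ {f} {g} p → lift λ x → ≡.trans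
        (cong (from (lower f)) (≡.trans (≡.sym (to-from (lower g) x)) (≡.sym (lower p _))))
        (from-to (lower f) _) } }
  where
  open Perm
  compose : Perm A → Perm A → Perm A
  compose f g = record
    { to = λ x → to f (to g x)
    ; from = λ x → from g (from f x)
    ; to-from = λ x → ≡.trans (cong (to f) (to-from g _)) (to-from f x)
    ; from-to = λ x → ≡.trans (cong (from g) (from-to f _)) (from-to g x) }
  inverse : Perm A → Perm A
  inverse f = record { to = from f ; from = to f ; to-from = from-to f ; from-to = to-from f }

iterate : {A : Set} → ℕ → (A → A) → A → A
iterate zero f x = x
iterate (sucℕ n) f x = f (iterate n f x)

-- Finite enumerations of a group.

record Cover {a ℓ : Level} (W : Group a ℓ) (n : ℕ) : Set (a Level.⊔ ℓ) where
  open Group W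
  field
    val : Fin n → Carrier
    -- A section of `val` on representatives; that it respects `_≈_` is known only once duplicates
    -- are removed, see `idx-cong`.
    idx : Carrier → Fin n
    val-idx : ∀ w → val (idx w) ≈ w

module Covers {a ℓ : Level} (W : Group a ℓ) where
  open Group W renaming (refl to ≈-refl; sym to ≈-sym; trans to ≈-trans)

  -- Whatever was indexed by `j` is sent to `i` instead. The equation on `n` lets callers recurse on
  -- the smaller size.
  drop : ∀ {n} (C : Cover W n) (i j : Fin n) → i ≢ j → Cover.val C i ≈ Cover.val C j →
    ∃[ k ] n ≡ sucℕ k × Cover W k
  drop {sucℕ n} C i j i≢j eq = n , refl , record
    { val = val ∘ punchIn j
    ; idx = λ w → proj₁ (index w)
    ; val-idx = λ w → proj₂ (index w) }
    where
    open Cover C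
    index : ∀ w → ∃[ k ] val (punchIn j k) ≈ w
    index w with idx w Fin.≟ j
    ... | yes p = punchOut (i≢j ∘ ≡.sym) , ≈-trans
      (≈-trans (reflexive (cong val (Fin.punchIn-punchOut (i≢j ∘ ≡.sym)))) eq)
      (≈-trans (reflexive (cong val (≡.sym p))) (val-idx w))
    ... | no q = punchOut (q ∘ ≡.sym) , ≈-trans
      (reflexive (cong val (Fin.punchIn-punchOut (q ∘ ≡.sym)))) (val-idx w)

  distinct : (∀ x y → Dec (x ≈ y)) → ∀ n → Cover W n →
    ∃[ k ] Σ[ C ∈ Cover W k ] (∀ i j → Cover.val C i ≈ Cover.val C j → i ≡ j)
  distinct _≟_ n C
    with Fin.any? (λ i → Fin.any? (λ j → ¬? (i Fin.≟ j) ×-dec (Cover.val C i ≟ Cover.val C j)))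
  ... | no none = n , C , λ i j eq → decidable-stable (i Fin.≟ j) λ i≢j → none (i , j , i≢j , eq)
  ... | yes (i , j , i≢j , eq) with drop C i j i≢j eq
  ... | k , refl , C′ = distinct _≟_ k C′

-- Decidability of equality in a finite Coxeter group.

module WordProblem {a ℓ : Level} (W : Group a ℓ) {r : ℕ} (s : Fin r → Group.Carrier W)
  (M : CoxeterMatrix r) (cox : IsCoxeterSystem W s M) where
  open Group W renaming (refl to ≈-refl; sym to ≈-sym; trans to ≈-trans)
  open CoxeterMatrix M
  open IsCoxeterSystem cox
  open GroupSolver W using (solve; x₀; x₁; x₂; x₃; _⊙_)

  eval : List (Fin r) → Carrier
  eval = evalS W s

  s² : ∀ i → s i ∙ s i ≈ ε
  s² i = ≈-trans (≈-sym (identityʳ _)) (subst (λ k → pow W (s i ∙ s i) k ≈ ε) (diag i) (relations i i))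

  -- The universal property in the only form needed below: an action of the generators
  -- satisfying the Coxeter relations does not distinguish words representing equal elements.
  word-action : {A : Set} (σ : Fin r → A → A) →
    (∀ i j x → iterate (m i j) (λ y → σ i (σ j y)) x ≡ x) →
    ∀ ws vs → eval ws ≈ eval vs → ∀ x → foldr σ x ws ≡ foldr σ x vs
  word-action {A} σ rel ws vs eq x =
    ≡.trans (≡.sym (φ-eval ws x)) (≡.trans (lower (⟦⟧-cong eq) x) (φ-eval vs x))
    where
    H : Group a ℓ
    H = permutationGroup a ℓ A
    module H = Group H
    -- The diagonal relation has exponent 1, so it makes `σ i` its own inverse.
    involutive : ∀ i x → σ i (σ i x) ≡ x
    involutive i x = subst (λ k → iterate k (λ y → σ i (σ i y)) x ≡ x) (diag i) (rel i i x)
    f : Fin r → H.Carrier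
    f i = lift (record { to = σ i ; from = σ i ; to-from = involutive i ; from-to = involutive i })
    to : H.Carrier → A → A
    to = Perm.to ∘ lower
    to-pow : ∀ i j n x → to (pow H (f i H.∙ f j) n) x ≡ iterate n (λ y → σ i (σ j y)) x
    to-pow i j zero x = refl
    to-pow i j (sucℕ n) x = cong (σ i ∘ σ j) (to-pow i j n x)
    extension = universal H f λ i j → lift λ x → ≡.trans (to-pow i j (m i j) x) (rel i j x)
    φ = proj₁ extension
    open GroupMorphisms.IsGroupHomomorphism (proj₁ (proj₂ extension))
    φ-eval : ∀ ws x → to (φ (eval ws)) x ≡ foldr σ x ws
    φ-eval [] x = lower ε-homo x
    φ-eval (i ∷ ws) x = ≡.trans (lower (homo (s i) (eval ws)) x)
      (≡.trans (lower (proj₂ (proj₂ extension) i) _) (cong (σ i) (φ-eval ws x)))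

  -- Todd–Coxeter style: the generators act on the indices of a cover; either this action
  -- satisfies the Coxeter relations, and then separates elements, or a failing relation
  -- exhibits two indices of the same element and the cover shrinks.
  decideWith : ∀ n → Cover W n → ∀ x y → Dec (x ≈ y)
  decideWith n C = go
    where
    open Cover C
    σ : Fin r → Fin n → Fin n
    σ k i = idx (s k ∙ val i)
    τ : Fin r → Fin r → ℕ → Fin n → Fin n
    τ k l e = iterate e (λ j → σ k (σ l j))
    val-τ : ∀ k l e i → val (τ k l e i) ≈ pow W (s k ∙ s l) e ∙ val i
    val-τ k l zero i = ≈-sym (identityˡ _)
    val-τ k l (sucℕ e) i = ≈-trans (val-idx _)
      (≈-trans (∙-congˡ (≈-trans (val-idx _) (∙-congˡ (val-τ k l e i))))
        (solve (s k ∷ s l ∷ pow W (s k ∙ s l) e ∷ val i ∷ []) []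
          (x₀ ⊙ (x₁ ⊙ (x₂ ⊙ x₃))) (x₀ ⊙ x₁ ⊙ x₂ ⊙ x₃) refl))
    val-rel : ∀ k l i → val (τ k l (m k l) i) ≈ val i
    val-rel k l i = ≈-trans (val-τ k l (m k l) i) (≈-trans (∙-congʳ (relations k l)) (identityˡ _))
    val-word : ∀ ws → val (foldr σ (idx ε) ws) ≈ eval ws
    val-word [] = val-idx ε
    val-word (k ∷ ws) = ≈-trans (val-idx _) (∙-congˡ (val-word ws))
    go : ∀ x y → Dec (x ≈ y)
    go with Fin.any? (λ k → Fin.any? (λ l → Fin.any? (λ i → ¬? (τ k l (m k l) i Fin.≟ i))))
    go | no none = λ x y → map′ (code-injective x y) (code-cong x y) (code x Fin.≟ code y)
      where
      rel : ∀ k l i → τ k l (m k l) i ≡ i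
      rel k l i = decidable-stable (_ Fin.≟ i) λ ne → none (k , l , i , ne)
      code : Carrier → Fin n
      code x = foldr σ (idx ε) (proj₁ (generates x))
      code-injective : ∀ x y → code x ≡ code y → x ≈ y
      code-injective x y eq = ≈-trans (≈-sym (≈-trans (val-word (proj₁ (generates x))) (proj₂ (generates x))))
        (≈-trans (reflexive (cong val eq)) (≈-trans (val-word (proj₁ (generates y))) (proj₂ (generates y))))
      code-cong : ∀ x y → x ≈ y → code x ≡ code y
      code-cong x y eq = word-action σ rel (proj₁ (generates x)) (proj₁ (generates y))
        (≈-trans (proj₂ (generates x)) (≈-trans eq (≈-sym (proj₂ (generates y))))) (idx ε)
    go | yes (k , l , i , ne) with Covers.drop W C _ i ne (val-rel k l i)
    ... | n′ , refl , C′ = decideWith n′ C′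

  cover : IsFinite W s → ∃[ n ] Cover W n
  cover (xs , covers) = List.length xs , record
    { val = List.lookup xs
    ; idx = λ w → Any.index (covers w)
    ; val-idx = λ w → ≈-sym (Any.lookup-index (covers w)) }

  decide : IsFinite W s → ∀ x y → Dec (x ≈ y)
  decide fin = decideWith _ (proj₂ (cover fin))

-- The parity of inversions and its independence of the word.

module Inversions {a ℓ : Level} (W : Group a ℓ) {r : ℕ} (s : Fin r → Group.Carrier W)
  (M : CoxeterMatrix r) (cox : IsCoxeterSystem W s M) (fin : IsFinite W s) where
  open Group W renaming (refl to ≈-refl; sym to ≈-sym; trans to ≈-trans)
  open CoxeterMatrix M
  open IsCoxeterSystem cox
  open GroupSolver W using (Involution; solve; x₀; x₁; x₂; x₃; τ₀; τ₁; _⊙_; _⁻; ι)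
  open WordProblem W s M cox
  open Relation.Binary.Reasoning.Setoid setoid

  opaque
    _≟_ : ∀ x y → Dec (x ≈ y)
    _≟_ = decide fin

    distinctCover : ∃[ k ] Σ[ C ∈ Cover W k ] (∀ i j → Cover.val C i ≈ Cover.val C j → i ≡ j)
    distinctCover = Covers.distinct W _≟_ _ (proj₂ (cover fin))

  S : Fin r → Involution
  S i = s i , s² i

  size : ℕ
  size = proj₁ distinctCover

  open Cover (proj₁ (proj₂ distinctCover)) public

  val-injective : ∀ i j → val i ≈ val j → i ≡ j
  val-injective = proj₂ (proj₂ distinctCover)

  idx-cong : ∀ {x y} → x ≈ y → idx x ≡ idx y
  idx-cong eq = val-injective _ _ (≈-trans (val-idx _) (≈-trans eq (≈-sym (val-idx _))))

  conj : Carrier → Carrier → Carrier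
  conj g x = g ∙ x ∙ g ⁻¹

  conj-cong : ∀ {g h x y} → g ≈ h → x ≈ y → conj g x ≈ conj h y
  conj-cong p q = ∙-cong (∙-cong p q) (⁻¹-cong p)

  conj-∙ : ∀ g h x → conj (g ∙ h) x ≈ conj g (conj h x)
  conj-∙ g h x = solve (g ∷ h ∷ x ∷ []) []
    (x₀ ⊙ x₁ ⊙ x₂ ⊙ (x₀ ⊙ x₁) ⁻) (x₀ ⊙ (x₁ ⊙ x₂ ⊙ x₁ ⁻) ⊙ x₀ ⁻) refl

  conj-ε : ∀ x → conj ε x ≈ x
  conj-ε x = solve (x ∷ []) [] (ι ⊙ x₀ ⊙ ι ⁻) x₀ refl

  conj⁻¹-conj : ∀ g x → conj (g ⁻¹) (conj g x) ≈ x
  conj⁻¹-conj g x = solve (g ∷ x ∷ []) [] (x₀ ⁻ ⊙ (x₀ ⊙ x₁ ⊙ x₀ ⁻) ⊙ x₀ ⁻ ⁻) x₁ refl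

  conj-conj⁻¹ : ∀ g x → conj g (conj (g ⁻¹) x) ≈ x
  conj-conj⁻¹ g x = solve (g ∷ x ∷ []) [] (x₀ ⊙ (x₀ ⁻ ⊙ x₁ ⊙ x₀ ⁻ ⁻) ⊙ x₀ ⁻) x₁ refl

  hit : Carrier → Carrier → Bool
  hit x y = does (x ≟ y)

  hit-⇔ : ∀ {x y x′ y′} → (x ≈ y → x′ ≈ y′) → (x′ ≈ y′ → x ≈ y) → hit x y ≡ hit x′ y′
  hit-⇔ {x} {y} {x′} {y′} p q = does-⇔ (mk⇔ p q) (x ≟ y) (x′ ≟ y′)

  hit-cong : ∀ {x y x′ y′} → x ≈ x′ → y ≈ y′ → hit x y ≡ hit x′ y′
  hit-cong p q = hit-⇔ (λ e → ≈-trans (≈-sym p) (≈-trans e q)) (λ e → ≈-trans p (≈-trans e (≈-sym q)))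

  hit-true : ∀ x y → hit x y ≡ true → x ≈ y
  hit-true x y eq with x ≟ y
  ... | yes p = p

  hit-refl : ∀ x → hit x x ≡ true
  hit-refl x with x ≟ x
  ... | yes _ = refl
  ... | no ne = contradiction ≈-refl ne

  hit-conj : ∀ g {x y z} → conj (g ⁻¹) y ≈ z → hit (conj g x) y ≡ hit x z
  hit-conj g {x} {y} {z} eq = hit-⇔
    (λ e → ≈-trans (≈-sym (conj⁻¹-conj g x)) (≈-trans (conj-cong ≈-refl e) eq))
    (λ e → ≈-trans (conj-cong ≈-refl (≈-trans e (≈-sym eq))) (conj-conj⁻¹ g y))

  -- The parity of the number of positions at which x occurs in the sequence of right
  -- inversions of the word.
  parity : List (Fin r) → Carrier → Bool
  parity [] x = false
  parity (i ∷ ws) x = hit (conj (eval ws) x) (s i) xor parity ws x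

  parity-cong : ∀ ws {x y} → x ≈ y → parity ws x ≡ parity ws y
  parity-cong [] p = refl
  parity-cong (i ∷ ws) p = cong₂ _xor_ (hit-cong (conj-cong ≈-refl p) ≈-refl) (parity-cong ws p)

  pow-+ : ∀ x k n → pow W x (k + n) ≈ pow W x k ∙ pow W x n
  pow-+ x zero n = ≈-sym (identityˡ _)
  pow-+ x (sucℕ k) n = ≈-trans (∙-congˡ (pow-+ x k n)) (≈-sym (assoc _ _ _))

  pow-comm : ∀ x k → pow W x k ∙ x ≈ x ∙ pow W x k
  pow-comm x zero = ≈-trans (identityˡ _) (≈-sym (identityʳ _))
  pow-comm x (sucℕ k) = ≈-trans (assoc _ _ _) (∙-congˡ (pow-comm x k))

  module Braid (i j : Fin r) where
    alternating : ℕ → List (Fin r)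
    alternating zero = []
    alternating (sucℕ k) = i ∷ j ∷ alternating k

    p : Carrier
    p = s j ∙ s i

    -- Conjugation by `s j` inverts `p`, a product of two involutions, and hence its powers.
    s-pow-s : ∀ k → pow W p k ∙ s j ∙ pow W p k ≈ s j
    s-pow-s zero = solve [] (S j ∷ []) (ι ⊙ τ₀ ⊙ ι) τ₀ refl
    s-pow-s (sucℕ k) = begin
      p ∙ P ∙ s j ∙ (p ∙ P)        ≈⟨ ∙-congˡ (pow-comm p k) ⟨
      p ∙ P ∙ s j ∙ (P ∙ p)        ≈⟨ solve (p ∷ P ∷ []) (S j ∷ []) (x₀ ⊙ x₁ ⊙ τ₀ ⊙ (x₁ ⊙ x₀)) (x₀ ⊙ (x₁ ⊙ τ₀ ⊙ x₁) ⊙ x₀) refl ⟩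
      p ∙ (P ∙ s j ∙ P) ∙ p        ≈⟨ ∙-congʳ (∙-congˡ (s-pow-s k)) ⟩
      p ∙ s j ∙ p                  ≈⟨ solve [] (S j ∷ S i ∷ []) (τ₀ ⊙ τ₁ ⊙ τ₀ ⊙ (τ₀ ⊙ τ₁)) τ₀ refl ⟩
      s j                          ∎
      where
      P : Carrier
      P = pow W p k

    eval-alternating : ∀ k → eval (alternating k) ⁻¹ ≈ pow W p k
    eval-alternating zero = solve [] [] (ι ⁻) ι refl
    eval-alternating (sucℕ k) = begin
      (s i ∙ (s j ∙ g)) ⁻¹   ≈⟨ solve (g ∷ []) (S i ∷ S j ∷ []) ((τ₀ ⊙ (τ₁ ⊙ x₀)) ⁻) (x₀ ⁻ ⊙ (τ₁ ⊙ τ₀)) refl ⟩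
      g ⁻¹ ∙ p               ≈⟨ ∙-congʳ (eval-alternating k) ⟩
      pow W p k ∙ p          ≈⟨ pow-comm p k ⟩
      p ∙ pow W p k          ∎
      where
      g : Carrier
      g = eval (alternating k)

    -- Counting letters of `alternating` from the right, starting at 0, the letter at position `n`
    -- contributes the `n`-th power of `p` times `s j`. Here `n` is even; `odd-reflection` treats
    -- odd `n`.
    even-reflection : ∀ k → conj (eval (alternating k) ⁻¹) (s j) ≈ pow W p (k + k) ∙ s j
    even-reflection k = begin
      conj (eval (alternating k) ⁻¹) (s j)  ≈⟨ conj-cong (eval-alternating k) ≈-refl ⟩
      P ∙ s j ∙ P ⁻¹                        ≈⟨ ∙-congʳ (∙-congˡ (s-pow-s k)) ⟨
      P ∙ (P ∙ s j ∙ P) ∙ P ⁻¹              ≈⟨ solve (P ∷ s j ∷ []) [] (x₀ ⊙ (x₀ ⊙ x₁ ⊙ x₀) ⊙ x₀ ⁻) (x₀ ⊙ x₀ ⊙ x₁) refl ⟩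
      P ∙ P ∙ s j                           ≈⟨ ∙-congʳ (pow-+ p k k) ⟨
      pow W p (k + k) ∙ s j                 ∎
      where
      P : Carrier
      P = pow W p k

    odd-reflection : ∀ k → conj ((s j ∙ eval (alternating k)) ⁻¹) (s i) ≈ pow W p (sucℕ (k + k)) ∙ s j
    odd-reflection k = begin
      conj ((s j ∙ g) ⁻¹) (s i)   ≈⟨ solve (g ∷ []) (S j ∷ S i ∷ []) ((τ₀ ⊙ x₀) ⁻ ⊙ τ₁ ⊙ (τ₀ ⊙ x₀) ⁻ ⁻) (x₀ ⁻ ⊙ (τ₀ ⊙ τ₁) ⊙ x₀ ⊙ (x₀ ⁻ ⊙ τ₀ ⊙ x₀ ⁻ ⁻)) refl ⟩
      g ⁻¹ ∙ p ∙ g ∙ conj (g ⁻¹) (s j) ≈⟨ ∙-cong (∙-congʳ (∙-congʳ (eval-alternating k))) (even-reflection k) ⟩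
      P ∙ p ∙ g ∙ (pow W p (k + k) ∙ s j) ≈⟨ ∙-congʳ (∙-congʳ (pow-comm p k)) ⟩
      p ∙ P ∙ g ∙ (pow W p (k + k) ∙ s j) ≈⟨ ∙-congʳ (∙-congʳ (∙-congˡ (eval-alternating k))) ⟨
      p ∙ g ⁻¹ ∙ g ∙ (pow W p (k + k) ∙ s j) ≈⟨ solve (p ∷ g ∷ pow W p (k + k) ∷ s j ∷ []) [] (x₀ ⊙ x₁ ⁻ ⊙ x₁ ⊙ (x₂ ⊙ x₃)) (x₀ ⊙ x₂ ⊙ x₃) refl ⟩
      p ∙ pow W p (k + k) ∙ s j ∎
      where
      P g : Carrier
      P = pow W p k
      g = eval (alternating k)

    module _ (x : Carrier) where
      f : ℕ → Bool
      f k = hit x (pow W p k ∙ s j)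

      F : ℕ → Bool
      F zero = false
      F (sucℕ k) = f k xor F k

      parity-alternating : ∀ k → parity (alternating k) x ≡ F (k + k)
      parity-alternating zero = refl
      parity-alternating (sucℕ k) = ≡.trans
        (cong₂ _xor_ (hit-conj (s j ∙ eval (alternating k)) (odd-reflection k))
          (cong₂ _xor_ (hit-conj (eval (alternating k)) (even-reflection k)) (parity-alternating k)))
        (cong F (cong sucℕ (≡.sym (ℕ.+-suc k k))))

      p^m : pow W p (m i j) ≈ ε
      p^m = subst (λ k → pow W p k ≈ ε) (symm j i) (relations j i)

      F-periodic : ∀ k → F (k + m i j) ≡ F k xor F (m i j)
      F-periodic zero = refl
      F-periodic (sucℕ k) = ≡.trans
        (cong₂ _xor_ (hit-cong ≈-refl (∙-congʳ (≈-trans (pow-+ p k (m i j)) (≈-trans (∙-congˡ p^m) (identityʳ _))))) (F-periodic k))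
        (≡.sym (Bool.xor-assoc (f k) (F k) (F (m i j))))

      -- The word has twice `m i j` letters, and `p` to the power `m i j` is trivial, so its two
      -- halves run through the same reflections and `x` is met an even number of times.
      parity-relation : parity (alternating (m i j)) x ≡ false
      parity-relation = ≡.trans (parity-alternating (m i j))
        (≡.trans (F-periodic (m i j)) (Bool.xor-same (F (m i j))))

    eval-relation : eval (alternating (m i j)) ≈ ε
    eval-relation = begin
      eval (alternating (m i j))           ≈⟨ solve (eval (alternating (m i j)) ∷ []) [] x₀ (x₀ ⁻ ⁻) refl ⟩
      eval (alternating (m i j)) ⁻¹ ⁻¹     ≈⟨ ⁻¹-cong (≈-trans (eval-alternating (m i j)) (p^m ε)) ⟩
      ε ⁻¹                                 ≈⟨ solve [] [] (ι ⁻) ι refl ⟩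
      ε                                    ∎

  -- The classical action on signed reflections, extended to all group elements: conjugate, and
  -- change the sign when the element is the acting generator. Indices stand for elements because
  -- `word-action` speaks of propositional equality.
  σ : Fin r → Fin size × Bool → Fin size × Bool
  σ k (i , b) = idx (conj (s k) (val i)) , hit (val i) (s k) xor b

  σ-word : ∀ ws x b → foldr σ (idx x , b) ws ≡ (idx (conj (eval ws) x) , parity ws x xor b)
  σ-word [] x b = cong (_, b) (idx-cong (≈-sym (conj-ε x)))
  σ-word (k ∷ ws) x b rewrite σ-word ws x b = cong₂ _,_
    (idx-cong (≈-trans (conj-cong ≈-refl (val-idx _)) (≈-sym (conj-∙ (s k) (eval ws) x))))
    (≡.trans (cong (_xor _) (hit-cong (val-idx _) ≈-refl)) (≡.sym (Bool.xor-assoc (hit (conj (eval ws) x) (s k)) (parity ws x) b)))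

  σ-relation : ∀ i j z → iterate (m i j) (λ y → σ i (σ j y)) z ≡ z
  σ-relation i j (k , b) = ≡.trans (as-word (m i j))
    (≡.trans (cong (λ k′ → foldr σ (k′ , b) (alternating (m i j))) (val-injective _ _ (≈-sym (val-idx (val k)))))
    (≡.trans (σ-word (alternating (m i j)) (val k) b)
    (cong₂ _,_
      (val-injective _ _ (≈-trans (val-idx _) (≈-trans (conj-cong eval-relation ≈-refl) (conj-ε _))))
      (cong (_xor b) (parity-relation (val k))))))
    where
    open Braid i j
    as-word : ∀ e → iterate e (λ y → σ i (σ j y)) (k , b) ≡ foldr σ (k , b) (alternating e)
    as-word zero = refl
    as-word (sucℕ e) = cong (σ i ∘ σ j) (as-word e)

  -- Both words act alike on `(idx x , false)`, and the sign component of the result is the parity.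
  parity-well-defined : ∀ ws vs x → eval ws ≈ eval vs → parity ws x ≡ parity vs x
  parity-well-defined ws vs x eq = ≡.trans (≡.sym (Bool.xor-identityʳ _))
    (≡.trans (cong proj₂ (≡.trans (≡.sym (σ-word ws x false))
      (≡.trans (word-action σ σ-relation ws vs eq (idx x , false)) (σ-word vs x false))))
    (Bool.xor-identityʳ _))

-- Length, right inversions and the exchange property.

least : ∀ {ℓ} {P : ℕ → Set ℓ} → (∀ n → Dec (P n)) → ∀ n → P n →
  ∃[ k ] (P k × ∀ j → P j → k ≤ j)
least P? n p with P? 0
... | yes p₀ = 0 , p₀ , λ _ _ → z≤n
least P? zero p | no ¬p₀ = contradiction p ¬p₀
least {P = P} P? (sucℕ n) p | no ¬p₀ with least {P = P ∘ sucℕ} (P? ∘ sucℕ) n p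
... | k , pk , min = sucℕ k , pk , λ { zero q → contradiction q ¬p₀ ; (sucℕ j) q → s≤s (min j q) }

module Length {a ℓ : Level} (W : Group a ℓ) {r : ℕ} (s : Fin r → Group.Carrier W)
  (M : CoxeterMatrix r) (cox : IsCoxeterSystem W s M) (fin : IsFinite W s) where
  open Group W renaming (refl to ≈-refl; sym to ≈-sym; trans to ≈-trans)
  open IsCoxeterSystem cox
  open GroupSolver W using (solve; x₀; x₁; τ₀; _⊙_; _⁻; ι)
  open WordProblem W s M cox
  open Inversions W s M cox fin
  open Relation.Binary.Reasoning.Setoid setoid

  Refl : Carrier → Set _
  Refl = IsReflection W s

  hasWord? : ∀ w n → Dec (∃[ ws ] (length ws ≡ n × eval ws ≈ w))
  hasWord? w zero = map′ (λ p → [] , refl , ≈-sym p) (λ { ([] , _ , p) → ≈-sym p }) (w ≟ ε)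
  hasWord? w (sucℕ n) = map′
    (λ { (i , ws , p , q) → i ∷ ws , cong sucℕ p , ≈-trans (∙-congˡ q) (solve (w ∷ []) (S i ∷ []) (τ₀ ⊙ (τ₀ ⊙ x₀)) x₀ refl) })
    (λ { (i ∷ ws , p , q) → i , ws , ℕ.suc-injective p ,
           ≈-trans (solve (eval ws ∷ []) (S i ∷ []) x₀ (τ₀ ⊙ (τ₀ ⊙ x₀)) refl) (∙-congˡ q) })
    (Fin.any? λ i → hasWord? (s i ∙ w) n)

  opaque
    hasLength : ∀ w → ∃[ n ] HasLenS W s w n
    hasLength w = let ws , eq = generates w
                      n , word , min = least (hasWord? w) (length ws) (ws , refl , eq)
                  in n , word , λ vs e → min _ (vs , refl , e)

  len : Carrier → ℕ
  len w = proj₁ (hasLength w)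

  len-≤ : ∀ {w} ws → eval ws ≈ w → len w ≤ length ws
  len-≤ {w} ws = proj₂ (proj₂ (hasLength w)) ws

  shortest : ∀ w → ∃[ ws ] (length ws ≡ len w × eval ws ≈ w)
  shortest w = proj₁ (proj₂ (hasLength w))

  HasLenS⇒len : ∀ {w n} → HasLenS W s w n → len w ≡ n
  HasLenS⇒len {w} ((ws , refl , eq) , min) with shortest w
  ... | vs , p , q = ℕ.≤-antisym (len-≤ ws eq) (ℕ.≤-trans (min vs q) (ℕ.≤-reflexive p))

  len⇒HasLenS : ∀ {w n} → len w ≡ n → HasLenS W s w n
  len⇒HasLenS {w} refl = proj₂ (hasLength w)

  len-cong : ∀ {u v} → u ≈ v → len u ≡ len v
  len-cong {u} {v} eq with shortest u | shortest v
  ... | ws , p , q | ws′ , p′ , q′ = ℕ.≤-antisym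
    (ℕ.≤-trans (len-≤ ws′ (≈-trans q′ (≈-sym eq))) (ℕ.≤-reflexive p′))
    (ℕ.≤-trans (len-≤ ws (≈-trans q eq)) (ℕ.≤-reflexive p))

  eval-++ : ∀ ws vs → eval (ws ++ vs) ≈ eval ws ∙ eval vs
  eval-++ [] vs = ≈-sym (identityˡ _)
  eval-++ (i ∷ ws) vs = ≈-trans (∙-congˡ (eval-++ ws vs)) (≈-sym (assoc _ _ _))

  eval-reverse : ∀ ws → eval (reverse ws) ≈ eval ws ⁻¹
  eval-reverse [] = solve [] [] ι (ι ⁻) refl
  eval-reverse (i ∷ ws) = begin
    eval (reverse (i ∷ ws))           ≡⟨ cong eval (List.unfold-reverse i ws) ⟩
    eval (reverse ws ++ i ∷ [])       ≈⟨ eval-++ (reverse ws) (i ∷ []) ⟩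
    eval (reverse ws) ∙ (s i ∙ ε)     ≈⟨ ∙-congʳ (eval-reverse ws) ⟩
    eval ws ⁻¹ ∙ (s i ∙ ε)                      ≈⟨ solve (eval ws ∷ []) (S i ∷ []) (x₀ ⁻ ⊙ (τ₀ ⊙ ι)) ((τ₀ ⊙ x₀) ⁻) refl ⟩
    (s i ∙ eval ws) ⁻¹                          ∎

  len-∙ : ∀ u v → len (u ∙ v) ≤ len u + len v
  len-∙ u v with shortest u | shortest v
  ... | ws , p , q | ws′ , p′ , q′ = ℕ.≤-trans
    (len-≤ (ws ++ ws′) (≈-trans (eval-++ ws ws′) (∙-cong q q′)))
    (ℕ.≤-reflexive (≡.trans (List.length-++ ws) (cong₂ _+_ p p′)))

  len-⁻¹-≤ : ∀ u → len (u ⁻¹) ≤ len u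
  len-⁻¹-≤ u with shortest u
  ... | ws , p , q = ℕ.≤-trans (len-≤ (reverse ws) (≈-trans (eval-reverse ws) (⁻¹-cong q)))
    (ℕ.≤-reflexive (≡.trans (List.length-reverse ws) p))

  len-⁻¹ : ∀ u → len (u ⁻¹) ≡ len u
  len-⁻¹ u = ℕ.≤-antisym (len-⁻¹-≤ u)
    (ℕ.≤-trans (ℕ.≤-reflexive (len-cong (solve (u ∷ []) [] x₀ (x₀ ⁻ ⁻) refl))) (len-⁻¹-≤ (u ⁻¹)))

  len-ε : len ε ≡ 0
  len-ε = ℕ.n≤0⇒n≡0 (len-≤ [] ≈-refl)

  len≡0 : ∀ {w} → len w ≡ 0 → w ≈ ε
  len≡0 {w} eq with shortest w
  ... | [] , _ , q = ≈-sym q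
  ... | _ ∷ _ , p , _ = contradiction (≡.trans p eq) λ ()

  len-s-≤ : ∀ i → len (s i) ≤ 1
  len-s-≤ i = len-≤ (i ∷ []) (identityʳ _)

  len-sˡ-≤ : ∀ i w → len (s i ∙ w) ≤ sucℕ (len w)
  len-sˡ-≤ i w = ℕ.≤-trans (len-∙ (s i) w) (ℕ.+-monoˡ-≤ (len w) (len-s-≤ i))

  len-sʳ-≤ : ∀ i w → len (w ∙ s i) ≤ sucℕ (len w)
  len-sʳ-≤ i w = ℕ.≤-trans (len-∙ w (s i))
    (ℕ.≤-trans (ℕ.+-monoʳ-≤ (len w) (len-s-≤ i)) (ℕ.≤-reflexive (ℕ.+-comm (len w) 1)))

  parity-++ : ∀ ws vs x → parity (ws ++ vs) x ≡ parity vs x xor parity ws (conj (eval vs) x)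
  parity-++ [] vs x = ≡.sym (Bool.xor-identityʳ _)
  parity-++ (i ∷ ws) vs x = ≡.trans
    (cong₂ _xor_ (hit-cong (≈-trans (conj-cong (eval-++ ws vs) ≈-refl) (conj-∙ _ _ _)) ≈-refl) (parity-++ ws vs x))
    (swap (hit (conj (eval ws) (conj (eval vs) x)) (s i)) (parity vs x) (parity ws (conj (eval vs) x)))
    where
    swap : ∀ x y z → x xor (y xor z) ≡ y xor (x xor z)
    swap x y z = ≡.trans (≡.sym (Bool.xor-assoc x y z))
      (≡.trans (cong (_xor z) (Bool.xor-comm x y)) (Bool.xor-assoc y x z))

  opaque
    -- For a reflection t, N w t says that t is a right inversion of w.
    N : Carrier → Carrier → Bool
    N w = parity (proj₁ (generates w))

    N-eval : ∀ {w} ws x → eval ws ≈ w → N w x ≡ parity ws x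
    N-eval {w} ws x eq = parity-well-defined (proj₁ (generates w)) ws x
      (≈-trans (proj₂ (generates w)) (≈-sym eq))

    N-congʳ : ∀ w {x y} → x ≈ y → N w x ≡ N w y
    N-congʳ w = parity-cong (proj₁ (generates w))

    N-congˡ : ∀ {u v} x → u ≈ v → N u x ≡ N v x
    N-congˡ {u} {v} x eq = N-eval (proj₁ (generates v)) x (≈-trans (proj₂ (generates v)) (≈-sym eq))

    -- The cocycle identity: in a concatenated word the letters of `v` meet `x` itself, while those
    -- of `u` meet it conjugated by `v`.
    N-∙ : ∀ u v x → N (u ∙ v) x ≡ N v x xor N u (conj v x)
    N-∙ u v x = let us , p = generates u ; vs , q = generates v in ≡.trans
      (N-eval (us ++ vs) x (≈-trans (eval-++ us vs) (∙-cong p q)))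
      (≡.trans (parity-++ us vs x) (cong (parity vs x xor_) (parity-cong us (conj-cong q ≈-refl))))

  N-s : ∀ i x → N (s i) x ≡ hit x (s i)
  N-s i x = ≡.trans (N-eval (i ∷ []) x (identityʳ _))
    (≡.trans (Bool.xor-identityʳ _) (hit-cong (conj-ε x) ≈-refl))

  N-ε : ∀ x → N ε x ≡ false
  N-ε x = N-eval [] x ≈-refl

  N-⁻¹ : ∀ w x → N (w ⁻¹) x ≡ N w (conj (w ⁻¹) x)
  N-⁻¹ w x = xor-false (≡.trans (≡.sym (N-∙ w (w ⁻¹) x)) (≡.trans (N-congˡ x (inverseʳ w)) (N-ε x)))
    where
    xor-false : ∀ {x y} → x xor y ≡ false → x ≡ y
    xor-false {false} {false} _ = refl
    xor-false {true} {true} _ = refl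

  Refl-s : ∀ i → Refl (s i)
  Refl-s i = ε , i , ≈-sym (conj-ε (s i))

  Refl-conj : ∀ g {t} → Refl t → Refl (conj g t)
  Refl-conj g (w , i , eq) = g ∙ w , i , ≈-trans (conj-cong ≈-refl eq) (≈-sym (conj-∙ g w (s i)))

  Refl-cong : ∀ {t t′} → t ≈ t′ → Refl t → Refl t′
  Refl-cong p (w , i , eq) = w , i , ≈-trans (≈-sym p) eq

  Refl² : ∀ {t} → Refl t → t ∙ t ≈ ε
  Refl² (w , i , eq) = ≈-trans (∙-cong eq eq)
    (solve (w ∷ []) (S i ∷ []) (x₀ ⊙ τ₀ ⊙ x₀ ⁻ ⊙ (x₀ ⊙ τ₀ ⊙ x₀ ⁻)) ι refl)

  -- In the palindrome of `w`, `s i` and the inverse of `w`, the two outer contributions cancel and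
  -- the middle letter counts once.
  N-self : ∀ {t} → Refl t → N t t ≡ true
  N-self {t} (w , i , eq) =
    ≡.trans (N-congˡ t eq)
    (≡.trans (N-∙ (w ∙ s i) (w ⁻¹) t)
    (≡.trans (cong₂ _xor_ (N-⁻¹ w t) (N-∙ w (s i) t′))
    (≡.trans (cong (N w t′ xor_) (cong₂ _xor_
        (≡.trans (N-s i t′) (≡.trans (hit-cong t′≈s ≈-refl) (hit-refl (s i))))
        (N-congʳ w conj-t′)))
    (lemma (N w t′)))))
    where
    t′ : Carrier
    t′ = conj (w ⁻¹) t
    t′≈s : t′ ≈ s i
    t′≈s = ≈-trans (conj-cong ≈-refl eq) (conj⁻¹-conj w (s i))
    conj-t′ : conj (s i) t′ ≈ t′
    conj-t′ = ≈-trans (conj-cong ≈-refl t′≈s)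
      (≈-trans (solve [] (S i ∷ []) (τ₀ ⊙ τ₀ ⊙ τ₀ ⁻) τ₀ refl) (≈-sym t′≈s))
    lemma : ∀ x → x xor (true xor x) ≡ true
    lemma false = refl
    lemma true = refl

  N-∙-self : ∀ w {t} → Refl t → N (w ∙ t) t ≡ not (N w t)
  N-∙-self w {t} R = ≡.trans (N-∙ w t t) (cong₂ _xor_ (N-self R)
    (N-congʳ w (solve (t ∷ []) [] (x₀ ⊙ x₀ ⊙ x₀ ⁻) x₀ refl)))

  opaque
    -- Odd parity means that some letter is hit, and deleting that letter multiplies the word by
    -- `t`. The clause on `All P` keeps the result inside any parabolic subgroup containing the
    -- letters.
    exchange : ∀ ws t → parity ws t ≡ true →
      ∃[ vs ] (sucℕ (length vs) ≡ length ws × eval vs ≈ eval ws ∙ t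
               × ∀ {P : Fin r → Set} → All P ws → All P vs)
    exchange (i ∷ ws) t eq with hit (conj (eval ws) t) (s i) in h
    ... | true = ws , refl , ≈-sym (begin
            s i ∙ g ∙ t                       ≈⟨ solve (g ∷ t ∷ []) (S i ∷ []) (τ₀ ⊙ x₀ ⊙ x₁) (τ₀ ⊙ (x₀ ⊙ x₁ ⊙ x₀ ⁻) ⊙ x₀) refl ⟩
            s i ∙ conj g t ∙ g                ≈⟨ ∙-congʳ (∙-congˡ (hit-true _ _ h)) ⟩
            s i ∙ s i ∙ g                     ≈⟨ solve (g ∷ []) (S i ∷ []) (τ₀ ⊙ τ₀ ⊙ x₀) x₀ refl ⟩
            g                                 ∎)
          , λ { (_ ∷ p) → p }
      where
      g : Carrier
      g = eval ws
    ... | false with exchange ws t eq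
    ... | vs , p , q , sub = i ∷ vs , cong sucℕ p , ≈-trans (∙-congˡ q) (≈-sym (assoc _ _ _))
          , λ { (x ∷ xs) → x ∷ sub xs }

  N-true : ∀ {w t} → N w t ≡ true → len (w ∙ t) < len w
  N-true {w} {t} eq with shortest w
  ... | ws , p , q with exchange ws t (≡.trans (≡.sym (N-eval ws t q)) eq)
  ... | vs , p′ , q′ , _ = ℕ.≤-trans (s≤s (len-≤ vs (≈-trans q′ (∙-congʳ q)))) (ℕ.≤-reflexive (≡.trans p′ p))

  -- `t` has the opposite status at `w ∙ t`, where `N-true` applies.
  N-false : ∀ {w t} → Refl t → N w t ≡ false → len w < len (w ∙ t)
  N-false {w} {t} R eq = ≡.subst (_< len (w ∙ t))
    (len-cong (≈-trans (assoc w t t) (≈-trans (∙-congˡ (Refl² R)) (identityʳ w))))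
    (N-true (≡.trans (N-∙-self w R) (cong not eq)))

  <⇒N-false : ∀ {w t} → len w ≤ len (w ∙ t) → N w t ≡ false
  <⇒N-false {w} {t} lt with N w t in eq
  ... | false = refl
  ... | true = contradiction (N-true eq) (ℕ.≤⇒≯ lt)

  >⇒N-true : ∀ {w t} → Refl t → len (w ∙ t) ≤ len w → N w t ≡ true
  >⇒N-true {w} {t} R lt with N w t in eq
  ... | true = refl
  ... | false = contradiction (N-false R eq) (ℕ.≤⇒≯ lt)

  N-s-false : ∀ {w i} → N w (s i) ≡ false → len (w ∙ s i) ≡ sucℕ (len w)
  N-s-false {w} {i} eq = ℕ.≤-antisym (len-sʳ-≤ i w) (N-false (Refl-s i) eq)

  N-s-true : ∀ {w i} → N w (s i) ≡ true → sucℕ (len (w ∙ s i)) ≡ len w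
  N-s-true {w} {i} eq = ℕ.≤-antisym (N-true eq)
    (ℕ.≤-trans (ℕ.≤-reflexive (len-cong (solve (w ∷ []) (S i ∷ []) x₀ (x₀ ⊙ τ₀ ⊙ τ₀) refl))) (len-sʳ-≤ i (w ∙ s i)))

  len-s : ∀ i → len (s i) ≡ 1
  len-s i = ≡.trans (len-cong (≈-sym (identityˡ _)))
    (≡.trans (N-s-false (N-ε (s i))) (cong sucℕ len-ε))

  opaque
    -- A new first letter either lengthens a reduced word or, by `exchange`, deletes one of its
    -- letters. No letter outside `P` is ever introduced, so parabolic elements have reduced words
    -- in their own generators.
    reduce : ∀ {P : Fin r → Set} ws → All P ws →
      ∃[ vs ] (length vs ≡ len (eval ws) × eval vs ≈ eval ws × All P vs)
    reduce [] [] = [] , ≡.sym len-ε , ≈-refl , []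
    reduce {P} (i ∷ ws) (p ∷ ps) with reduce ws ps
    ... | vs , lv , ev , pv = by-cases (N g t) refl
      where
      g t : Carrier
      g = eval ws
      t = conj (g ⁻¹) (s i)
      Rt : Refl t
      Rt = Refl-conj (g ⁻¹) (Refl-s i)
      gt : g ∙ t ≈ s i ∙ g
      gt = solve (g ∷ []) (S i ∷ []) (x₀ ⊙ (x₀ ⁻ ⊙ τ₀ ⊙ x₀ ⁻ ⁻)) (τ₀ ⊙ x₀) refl
      by-cases : ∀ b → N g t ≡ b → ∃[ us ] (length us ≡ len (s i ∙ g) × eval us ≈ s i ∙ g × All P us)
      by-cases false eq = i ∷ vs
        , ≡.trans (cong sucℕ lv) (ℕ.≤-antisym (ℕ.≤-trans (N-false Rt eq) (ℕ.≤-reflexive (len-cong gt))) (len-sˡ-≤ i g))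
        , ∙-congˡ ev , p ∷ pv
      by-cases true eq with exchange vs t (≡.trans (≡.sym (N-eval vs t ev)) eq)
      ... | us , lu , eu , sub = us
        , ℕ.≤-antisym
            (s≤s⁻¹ (ℕ.≤-trans (ℕ.≤-reflexive (≡.trans lu (≡.trans lv
              (len-cong (solve (g ∷ []) (S i ∷ []) x₀ (τ₀ ⊙ (τ₀ ⊙ x₀)) refl)))))
              (len-sˡ-≤ i (s i ∙ g))))
            (len-≤ us us≈)
        , us≈ , sub pv
        where
        us≈ : eval us ≈ s i ∙ g
        us≈ = ≈-trans eu (≈-trans (∙-congʳ ev) gt)

-- Parabolic subgroups, minimal coset representatives and the longest element.

argmax : ∀ {n} (f : Fin (sucℕ n) → ℕ) → ∃[ i ] ∀ j → f j ≤ f i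
argmax {zero} f = fzero , λ { fzero → ℕ.≤-refl }
argmax {sucℕ n} f with argmax (f ∘ fsuc)
... | i , max with ℕ.≤-total (f fzero) (f (fsuc i))
... | inj₁ le = fsuc i , λ { fzero → le ; (fsuc j) → max j }
... | inj₂ ge = fzero , λ { fzero → ℕ.≤-refl ; (fsuc j) → ℕ.≤-trans (max j) ge }

module Parabolic {a ℓ : Level} (W : Group a ℓ) {r : ℕ} (s : Fin r → Group.Carrier W)
  (M : CoxeterMatrix r) (cox : IsCoxeterSystem W s M) (fin : IsFinite W s) where
  open Group W renaming (refl to ≈-refl; sym to ≈-sym; trans to ≈-trans)
  open IsCoxeterSystem cox
  open GroupSolver W using (solve; x₀; x₁; τ₀; _⊙_; _⁻; ι)
  open WordProblem W s M cox
  open Inversions W s M cox fin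
  open Length W s M cox fin
  open Relation.Binary.Reasoning.Setoid setoid

  Par : (Fin r → Set) → Carrier → Set ℓ
  Par P w = ∃[ ws ] (All P ws × eval ws ≈ w)

  module _ {P : Fin r → Set} where
    Par-cong : ∀ {u v} → u ≈ v → Par P u → Par P v
    Par-cong eq (ws , ps , e) = ws , ps , ≈-trans e eq

    Par-ε : Par P ε
    Par-ε = [] , [] , ≈-refl

    Par-s : ∀ {k} → P k → Par P (s k)
    Par-s {k} p = k ∷ [] , p ∷ [] , identityʳ _

    Par-∙ : ∀ {u v} → Par P u → Par P v → Par P (u ∙ v)
    Par-∙ (us , ps , p) (vs , qs , q) = us ++ vs , All.++⁺ ps qs , ≈-trans (eval-++ us vs) (∙-cong p q)

    Par-⁻¹ : ∀ {u} → Par P u → Par P (u ⁻¹)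
    Par-⁻¹ (us , ps , p) = reverse us , ↭.All-resp-↭ (↭.↭-sym (↭.↭-reverse us)) ps , ≈-trans (eval-reverse us) (⁻¹-cong p)

    Par-conj : ∀ {g x} → Par P g → Par P x → Par P (conj g x)
    Par-conj p q = Par-∙ (Par-∙ p q) (Par-⁻¹ p)

    Par-unconj : ∀ {g x} → Par P g → Par P (conj g x) → Par P x
    Par-unconj {g} {x} p q = Par-cong (conj⁻¹-conj g x) (Par-conj (Par-⁻¹ p) q)

    opaque
      Par-reduced : ∀ {w} → Par P w → ∃[ vs ] (length vs ≡ len w × eval vs ≈ w × All P vs)
      Par-reduced (ws , ps , e) with reduce ws ps
      ... | vs , l , e′ , qs = vs , ≡.trans l (len-cong e) , ≈-trans e′ e , qs

    -- `exchange` writes `w ∙ t` as a subword, and `t` is its quotient by `w`.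
    Par-inversion : ∀ {w t} → Par P w → N w t ≡ true → Par P t
    Par-inversion {w} {t} (ws , ps , e) eq with exchange ws t (≡.trans (≡.sym (N-eval ws t e)) eq)
    ... | vs , _ , q , sub = Par-cong
      (≈-trans (∙-congˡ (≈-trans q (∙-congʳ e))) (solve (w ∷ t ∷ []) [] (x₀ ⁻ ⊙ (x₀ ⊙ x₁)) x₁ refl))
      (Par-∙ (Par-⁻¹ (ws , ps , e)) (vs , sub ps , ≈-refl))

    opaque
      descent : ∀ {b} → Par P b → ¬ b ≈ ε → ∃[ k ] (P k × N b (s k) ≡ true)
      -- A reduced word of the inverse has the last letter of `b` at its head.
      descent {b} p ne with Par-reduced (Par-⁻¹ p)
      ... | [] , _ , e , _ = contradiction
        (≈-trans (solve (b ∷ []) [] x₀ (x₀ ⁻ ⁻) refl) (≈-trans (⁻¹-cong (≈-sym e)) (solve [] [] (ι ⁻) ι refl))) ne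
      ... | k ∷ ws , l , e , q ∷ _ = k , q , >⇒N-true (Refl-s k)
        (ℕ.≤-trans (ℕ.≤-reflexive (≡.sym (len-⁻¹ (b ∙ s k))))
        (ℕ.≤-trans (len-≤ ws (begin
            eval ws               ≈⟨ solve (eval ws ∷ []) (S k ∷ []) x₀ (τ₀ ⊙ (τ₀ ⊙ x₀)) refl ⟩
            s k ∙ (s k ∙ eval ws) ≈⟨ ∙-congˡ e ⟩
            s k ∙ b ⁻¹            ≈⟨ solve (b ∷ []) (S k ∷ []) (τ₀ ⊙ x₀ ⁻) ((x₀ ⊙ τ₀) ⁻) refl ⟩
            (b ∙ s k) ⁻¹          ∎))
        (ℕ.≤-trans (ℕ.n≤1+n _) (ℕ.≤-reflexive (≡.trans l (len-⁻¹ b))))))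

    Par-induction : ∀ {q} (Q : Carrier → Set q) → (∀ {x y} → x ≈ y → Q x → Q y) → Q ε →
      (∀ b k → P k → Par P b → N b (s k) ≡ false → Q b → Q (b ∙ s k)) → ∀ {b} → Par P b → Q b
    Par-induction Q Q-cong Qε step {b} p = go _ b p refl
      where
      go : ∀ n b → Par P b → len b ≡ n → Q b
      go zero b p eq = Q-cong (≈-sym (len≡0 eq)) Qε
      go (sucℕ n) b p eq with descent p (λ e → contradiction (≡.trans (≡.sym eq) (≡.trans (len-cong e) len-ε)) λ ())
      ... | k , pk , d = Q-cong (solve (b ∷ []) (S k ∷ []) (x₀ ⊙ τ₀ ⊙ τ₀) x₀ refl)
        (step (b ∙ s k) k pk p′ (≡.trans (N-∙-self b (Refl-s k)) (cong not d))
          (go n (b ∙ s k) p′ (ℕ.suc-injective (≡.trans (N-s-true d) eq))))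
        where
        p′ : Par P (b ∙ s k)
        p′ = Par-∙ p (Par-s pk)

  Par-all : ∀ w → Par (λ _ → ⊤) w
  Par-all w = let ws , e = generates w in ws , All.universal (λ _ → tt) ws , e

  -- Minimality in the left coset, tested on simple reflections only; `Minimal⇒NoInversion` extends
  -- the test to all reflections of the subgroup.
  Minimal : (Fin r → Set) → Carrier → Set
  Minimal P a = ∀ k → P k → N a (s k) ≡ false

  module _ {P : Fin r → Set} where
    NoInversion : Carrier → Set _
    NoInversion a = ∀ t → Refl t → Par P t → N a t ≡ false

    -- An ascent from `b` to `b ∙ s k` remains one after multiplication by `a`: by the cocycle
    -- identity it could fail only if `a` inverted a reflection of the subgroup.
    len-NoInversion : ∀ {a b} → NoInversion a → Par P b → len (a ∙ b) ≡ len a + len b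
    len-NoInversion {a} strong = Par-induction (λ b → len (a ∙ b) ≡ len a + len b)
      (λ e p → ≡.trans (len-cong (∙-congˡ (≈-sym e))) (≡.trans p (cong (len a +_) (len-cong e))))
      (≡.trans (len-cong (identityʳ a)) (≡.sym (≡.trans (cong (len a +_) len-ε) (ℕ.+-identityʳ _))))
      (λ b k pk pb asc ih → ≡.trans (len-cong (≈-sym (assoc a b (s k))))
        (≡.trans (N-s-false (≡.trans (N-∙ a b (s k))
            (cong₂ _xor_ asc (strong _ (Refl-conj b (Refl-s k)) (Par-conj pb (Par-s pk))))))
        (≡.trans (cong sucℕ ih) (≡.trans (≡.sym (ℕ.+-suc _ _)) (cong (len a +_) (≡.sym (N-s-false asc)))))))

    -- Pass to shorter elements of the coset until one, `a′`, inverts no reflection of the subgroup,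
    -- and write `a` as `a′ ∙ b`. If `b` is trivial, so is the claim; otherwise `a` inherits a right
    -- descent of `b`, against minimality.
    Minimal⇒NoInversion : ∀ {a} → Minimal P a → NoInversion a
    Minimal⇒NoInversion {a} min t R pt with N a t in eq
    ... | false = refl
    ... | true = contradiction (impossible (sucℕ (len a)) a ε ℕ.≤-refl Par-ε (≈-sym (identityʳ a))) λ ()
      where
      -- descent on the length of elements a′ of the coset of a
      impossible : ∀ n a′ b → len a′ < n → Par P b → a ≈ a′ ∙ b → true ≡ false
      impossible (sucℕ n) a′ b lt pb e = by-cases (b ≟ ε)
        where
        strong : NoInversion a′
        strong t′ R′ pt′ with N a′ t′ in eq′
        ... | false = refl
        ... | true = impossible n (a′ ∙ t′) (t′ ∙ b) (ℕ.<-≤-trans (N-true eq′) (s≤s⁻¹ lt)) (Par-∙ pt′ pb)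
          (≈-trans e (solve (a′ ∷ b ∷ []) ((t′ , Refl² R′) ∷ []) (x₀ ⊙ x₁) (x₀ ⊙ τ₀ ⊙ (τ₀ ⊙ x₁)) refl))
        by-cases : Dec (b ≈ ε) → true ≡ false
        by-cases (yes b≈ε) = ≡.trans (≡.sym eq)
          (≡.trans (N-congˡ t (≈-trans e (≈-trans (∙-congˡ b≈ε) (identityʳ a′)))) (strong t R pt))
        by-cases (no b≉ε) with descent pb b≉ε
        ... | k , pk , d = ≡.trans (≡.sym (≡.trans (N-congˡ (s k) e) (≡.trans (N-∙ a′ b (s k))
          (cong₂ _xor_ d (strong _ (Refl-conj b (Refl-s k)) (Par-conj pb (Par-s pk))))))) (min k pk)

    len-Minimal : ∀ {a b} → Minimal P a → Par P b → len (a ∙ b) ≡ len a + len b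
    len-Minimal min = len-NoInversion (Minimal⇒NoInversion min)

    -- The mirror image of `len-Minimal`, obtained by passing to inverses.
    len-Minimalˡ : ∀ {x w} → (∀ k → P k → len x < len (s k ∙ x)) → Par P w → len (w ∙ x) ≡ len w + len x
    len-Minimalˡ {x} {w} asc p = ≡.trans (≡.sym (len-⁻¹ (w ∙ x)))
      (≡.trans (len-cong (solve (w ∷ x ∷ []) [] ((x₀ ⊙ x₁) ⁻) (x₁ ⁻ ⊙ x₀ ⁻) refl))
      (≡.trans (len-Minimal min (Par-⁻¹ p))
      (≡.trans (cong₂ _+_ (len-⁻¹ x) (len-⁻¹ w)) (ℕ.+-comm (len x) (len w)))))
      where
      min : Minimal P (x ⁻¹)
      min k pk = <⇒N-false (ℕ.≤-trans (ℕ.≤-reflexive (len-⁻¹ x)) (ℕ.≤-trans (ℕ.<⇒≤ (asc k pk))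
        (ℕ.≤-reflexive (≡.trans (≡.sym (len-⁻¹ (s k ∙ x)))
          (len-cong (solve (x ∷ []) (S k ∷ []) ((τ₀ ⊙ x₀) ⁻) (x₀ ⁻ ⊙ τ₀) refl))))))

    -- Each of `x` and `y` would be longer than the other by `len b`.
    Minimal-unique : ∀ {x y b} → Minimal P x → Minimal P y → Par P b → y ≈ x ∙ b → y ≈ x
    Minimal-unique {x} {y} {b} minx miny pb e = ≈-trans e (≈-trans (∙-congˡ (len≡0 b≡0)) (identityʳ x))
      where
      y≡ : len y ≡ len x + len b
      y≡ = ≡.trans (len-cong e) (len-Minimal minx pb)
      x≡ : len x ≡ len y + len b
      x≡ = ≡.trans (len-cong (≈-trans (solve (x ∷ b ∷ []) [] x₀ (x₀ ⊙ x₁ ⊙ x₁ ⁻) refl) (∙-congʳ (≈-sym e))))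
        (≡.trans (len-Minimal miny (Par-⁻¹ pb)) (cong (len y +_) (len-⁻¹ b)))
      b≡0 : len b ≡ 0
      b≡0 = ℕ.m+n≡0⇒n≡0 (len b) (ℕ.+-cancelˡ-≡ (len x) _ _
        (≡.trans (≡.sym (ℕ.+-assoc (len x) (len b) (len b)))
        (≡.trans (cong (_+ len b) (≡.sym y≡)) (≡.trans (≡.sym x≡) (≡.sym (ℕ.+-identityʳ _))))))

    opaque
      decompose : (∀ k → Dec (P k)) → ∀ w → ∃[ a ] ∃[ b ] (Minimal P a × Par P b × w ≈ a ∙ b)
      decompose P? w = go _ w refl
        where
        go : ∀ n w → len w ≡ n → ∃[ a ] ∃[ b ] (Minimal P a × Par P b × w ≈ a ∙ b)
        go n w eq with Fin.any? (λ k → P? k ×-dec (N w (s k) Bool.≟ true))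
        ... | no none = w , ε , (λ k pk → Bool.¬-not λ d → none (k , pk , d)) , Par-ε , ≈-sym (identityʳ w)
        go zero w eq | yes (k , pk , d) = contradiction (≡.trans (N-s-true d) eq) λ ()
        go (sucℕ n) w eq | yes (k , pk , d) with go n (w ∙ s k) (ℕ.suc-injective (≡.trans (N-s-true d) eq))
        ... | a , b , min , pb , e = a , b ∙ s k , min , Par-∙ pb (Par-s pk) ,
          ≈-trans (solve (w ∷ []) (S k ∷ []) x₀ (x₀ ⊙ τ₀ ⊙ τ₀) refl) (≈-trans (∙-congʳ e) (assoc a b (s k)))

  IsLongest : Carrier → Set _
  IsLongest m = ∀ w → len w ≤ len m

  opaque
    longest : ∃[ m ] IsLongest m
    longest = go size val idx val-idx
      where
      go : ∀ n (val : Fin n → Carrier) (idx : Carrier → Fin n) → (∀ w → val (idx w) ≈ w) → ∃[ m ] IsLongest m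
      go zero val idx val-idx = contradiction (idx ε) λ ()
      go (sucℕ n) val idx val-idx with argmax (len ∘ val)
      ... | i , max = val i , λ w → ≡.subst (_≤ len (val i)) (len-cong (val-idx w)) (max (idx w))

  longest-N : ∀ {m t} → IsLongest m → Refl t → N m t ≡ true
  longest-N L R = >⇒N-true R (L _)

  longest-⁻¹ : ∀ {m} → IsLongest m → IsLongest (m ⁻¹)
  longest-⁻¹ {m} L w = ℕ.≤-trans (L w) (ℕ.≤-reflexive (≡.sym (len-⁻¹ m)))

  -- `m` inverts every reflection, so each ascent while building `u` is a descent for `m ∙ u`.
  longest-len : ∀ {m} → IsLongest m → ∀ u → len (m ∙ u) + len u ≡ len m
  longest-len {m} L u = Par-induction (λ u → len (m ∙ u) + len u ≡ len m)
    (λ e p → ≡.trans (≡.sym (cong₂ _+_ (len-cong (∙-congˡ e)) (len-cong e))) p)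
    (≡.trans (cong₂ _+_ (len-cong (identityʳ m)) len-ε) (ℕ.+-identityʳ _))
    (λ b k _ _ asc ih → ≡.trans (cong₂ _+_ (len-cong (≈-sym (assoc m b (s k)))) (N-s-false asc))
      (≡.trans (ℕ.+-suc _ _) (≡.trans (cong (_+ len b) (N-s-true (≡.trans (N-∙ m b (s k))
        (cong₂ _xor_ asc (longest-N L (Refl-conj b (Refl-s k))))))) ih)))
    (Par-all u)

  longest-lenˡ : ∀ {m} → IsLongest m → ∀ u → len (u ∙ m) + len u ≡ len m
  longest-lenˡ {m} L u = ≡.trans
    (cong₂ _+_ (≡.trans (≡.sym (len-⁻¹ (u ∙ m))) (len-cong (solve (u ∷ m ∷ []) [] ((x₀ ⊙ x₁) ⁻) (x₁ ⁻ ⊙ x₀ ⁻) refl))) (≡.sym (len-⁻¹ u)))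
    (≡.trans (longest-len (longest-⁻¹ L) (u ⁻¹)) (len-⁻¹ m))

-- The left weak order.

module WeakOrder {a ℓ : Level} (W : Group a ℓ) {r : ℕ} (s : Fin r → Group.Carrier W)
  (M : CoxeterMatrix r) (cox : IsCoxeterSystem W s M) (fin : IsFinite W s) where
  open Group W renaming (refl to ≈-refl; sym to ≈-sym; trans to ≈-trans)
  open GroupSolver W using (solve; x₀; x₁; τ₀; _⊙_; _⁻; ι)
  open WordProblem W s M cox
  open Inversions W s M cox fin
  open Length W s M cox fin
  open Parabolic W s M cox fin
  open ℕ.≤-Reasoning

  opaque
    -- The factor `b` is the longest element of the parabolic subgroup: `m` inverts all its
    -- reflections and `z` none, so `b` must invert them all.
    longestPart : ∀ {P : Fin r → Set} {m} → IsLongest m → (∀ k → Dec (P k)) →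
      ∃[ z ] ∃[ b ] (Minimal P z × Par P b × m ≈ z ∙ b × ∀ t → Refl t → Par P t → N b t ≡ true)
    longestPart {P} {m} L P? with decompose P? m
    ... | z , b , min , pb , e = z , b , min , pb , e , λ t R pt → ≡.trans (≡.sym (Bool.xor-identityʳ _))
      (≡.trans (cong (N b t xor_) (≡.sym (Minimal⇒NoInversion min _ (Refl-conj b R) (Par-conj pb pt))))
      (≡.trans (≡.sym (N-∙ z b t)) (≡.trans (N-congˡ t (≈-sym e)) (longest-N L R))))

  opaque
    leftDescent : ∀ {g} → ¬ g ≈ ε → ∃[ i ] sucℕ (len (s i ∙ g)) ≡ len g
    leftDescent {g} ne with descent (Par-⁻¹ (Par-all g))
      (λ e → ne (≈-trans (solve (g ∷ []) [] x₀ (x₀ ⁻ ⁻) refl) (≈-trans (⁻¹-cong e) (solve [] [] (ι ⁻) ι refl))))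
    ... | i , _ , d = i , ≡.trans
      (cong sucℕ (≡.trans (≡.sym (len-⁻¹ (s i ∙ g))) (len-cong (solve (g ∷ []) (S i ∷ []) ((τ₀ ⊙ x₀) ⁻) (x₀ ⁻ ⊙ τ₀) refl))))
      (≡.trans (N-s-true d) (len-⁻¹ g))

  infix 4 _≼_
  -- Left weak order through additivity of lengths instead of reduced words; subadditivity supplies
  -- the reverse inequality. `≤L⇒≼` and `≼⇒≤L` translate.
  _≼_ : Carrier → Carrier → Set _
  u ≼ v = ∃[ w ] (v ≈ w ∙ u × len w + len u ≤ len v)

  ≼-reflexive : ∀ {u v} → u ≈ v → u ≼ v
  ≼-reflexive {u} e = ε , ≈-trans (≈-sym e) (≈-sym (identityˡ u)) ,
    ℕ.≤-reflexive (≡.trans (cong (_+ len u) len-ε) (len-cong e))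

  ≼-trans : ∀ {u v w} → u ≼ v → v ≼ w → u ≼ w
  ≼-trans {u} {v} {w} (g , e , le) (h , e′ , le′) = h ∙ g ,
    ≈-trans e′ (≈-trans (∙-congˡ e) (≈-sym (assoc h g u))) , (begin
      len (h ∙ g) + len u     ≤⟨ ℕ.+-monoˡ-≤ (len u) (len-∙ h g) ⟩
      len h + len g + len u   ≡⟨ ℕ.+-assoc (len h) (len g) (len u) ⟩
      len h + (len g + len u) ≤⟨ ℕ.+-monoʳ-≤ (len h) le ⟩
      len h + len v           ≤⟨ le′ ⟩
      len w                   ∎)

  ≼-step : ∀ {i u} → len u < len (s i ∙ u) → u ≼ s i ∙ u
  ≼-step {i} {u} lt = s i , ≈-refl , ℕ.≤-trans (ℕ.≤-reflexive (cong (_+ len u) (len-s i))) lt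

  opaque
    -- The step is a right descent of the quotient `w`, moved over to `u`.
    firstStep : ∀ {u v} → u ≼ v → ¬ u ≈ v → ∃[ i ] (len u < len (s i ∙ u) × s i ∙ u ≼ v)
    firstStep {u} {v} (w , e , le) ne
      with descent (Par-all w) (λ w≈ε → ne (≈-sym (≈-trans e (≈-trans (∙-congʳ w≈ε) (identityˡ u)))))
    ... | i , _ , d = i , ℕ.+-cancelˡ-≤ (len w′) _ _ up , w′ , e′ , (begin
        len w′ + len (s i ∙ u)    ≤⟨ ℕ.+-monoʳ-≤ (len w′) (len-sˡ-≤ i u) ⟩
        len w′ + sucℕ (len u)     ≤⟨ le′ ⟩
        len v                     ∎)
      where
      w′ : Carrier
      w′ = w ∙ s i
      e′ : v ≈ w′ ∙ (s i ∙ u)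
      e′ = ≈-trans e (solve (w ∷ u ∷ []) (S i ∷ []) (x₀ ⊙ x₁) (x₀ ⊙ τ₀ ⊙ (τ₀ ⊙ x₁)) refl)
      le′ : len w′ + sucℕ (len u) ≤ len v
      le′ = begin
        len w′ + sucℕ (len u)  ≡⟨ ℕ.+-suc _ _ ⟩
        sucℕ (len w′) + len u  ≡⟨ cong (_+ len u) (N-s-true d) ⟩
        len w + len u          ≤⟨ le ⟩
        len v                  ∎
      up : len w′ + sucℕ (len u) ≤ len w′ + len (s i ∙ u)
      up = ℕ.≤-trans le′ (ℕ.≤-trans (ℕ.≤-reflexive (len-cong e′)) (len-∙ w′ (s i ∙ u)))

  -- By the cocycle identity `t` could be lost only if `w` inverted `conj u t`. But `v` is
  -- `w ∙ conj u t` times `u ∙ t`, and then both factors would be shorter than `w` and `u`, against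
  -- additivity.
  N-mono : ∀ {u v t} → u ≼ v → Refl t → N u t ≡ true → N v t ≡ true
  N-mono {u} {v} {t} (w , e , le) R Nu with N w (conj u t) in Nw
  ... | false = ≡.trans (N-congˡ t e) (≡.trans (N-∙ w u t) (cong₂ _xor_ Nu Nw))
  ... | true = contradiction (begin-strict
      len v                                  ≡⟨ len-cong (≈-trans e (solve (w ∷ u ∷ []) ((t , Refl² R) ∷ []) (x₀ ⊙ x₁) (x₀ ⊙ (x₁ ⊙ τ₀ ⊙ x₁ ⁻) ⊙ (x₁ ⊙ τ₀)) refl)) ⟩
      len (w ∙ conj u t ∙ (u ∙ t))           ≤⟨ len-∙ _ _ ⟩
      len (w ∙ conj u t) + len (u ∙ t)       <⟨ ℕ.+-mono-< (N-true Nw) (N-true Nu) ⟩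
      len w + len u                          ≤⟨ le ⟩
      len v                                  ∎) (ℕ.<-irrefl refl)

  -- Regions of prescribed inversion statuses and their maxima.

  module SignRegion {k : ℕ} (ρ : Fin k → Carrier) (Rρ : ∀ i → Refl (ρ i)) (sign : Fin k → Bool) where
    Region : Carrier → Set
    Region u = ∀ i → N u (ρ i) ≡ sign i

    Region-cong : ∀ {u v} → u ≈ v → Region u → Region v
    Region-cong e y i = ≡.trans (N-congˡ (ρ i) (≈-sym e)) (y i)

    Region? : ∀ u → Dec (Region u)
    Region? u = Fin.all? λ i → N u (ρ i) Bool.≟ sign i

    Region-convex : ∀ {u v w} → u ≼ v → v ≼ w → Region u → Region w → Region v
    Region-convex {u} {v} {w} uv vw yu yw i with sign i | yu i | yw i
    ... | true | p | q = N-mono uv (Rρ i) p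
    ... | false | p | q with N v (ρ i) in eq
    ... | false = refl
    ... | true = contradiction (≡.trans (≡.sym (N-mono vw (Rρ i) eq)) q) λ ()

    -- `u` and `v` agree on `ρ i`, so `g` does not invert `conj u (ρ i)`; by `N-mono` neither does
    -- `h`.
    Region-geodesic : ∀ {u v g h} → Region u → Region v → v ≈ g ∙ u → h ≼ g → Region (h ∙ u)
    Region-geodesic {u} {v} {g} {h} yu yv e hg i = ≡.trans (N-∙ h u (ρ i))
      (≡.trans (cong₂ _xor_ (yu i) Nh) (Bool.xor-identityʳ (sign i)))
      where
      cancel : ∀ x y → x xor y ≡ x → y ≡ false
      cancel false false _ = refl
      cancel true false _ = refl
      Ng : N g (conj u (ρ i)) ≡ false
      Ng = cancel (sign i) _ (≡.trans (cong (_xor N g (conj u (ρ i))) (≡.sym (yu i)))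
        (≡.trans (≡.sym (N-∙ g u (ρ i))) (≡.trans (N-congˡ (ρ i) (≈-sym e)) (yv i))))
      Nh : N h (conj u (ρ i)) ≡ false
      Nh with N h (conj u (ρ i)) in eq
      ... | false = refl
      ... | true = contradiction (≡.trans (≡.sym (N-mono hg (Refl-conj u (Rρ i)) eq)) Ng) λ ()

    -- `unique` applies this to the longest element of the dihedral subgroup, which yields a common
    -- upper bound of the two neighbours.
    JoinClosed : Set _
    JoinClosed = ∀ u i j → Region u → Region (s i ∙ u) → Region (s j ∙ u) →
      len u < len (s i ∙ u) → len u < len (s j ∙ u) →
      ∀ w → Par (λ k → k ≡ i ⊎ k ≡ j) w → Region (w ∙ u)

    -- Newman's lemma: the region is connected, its upward steps terminate, and join
    -- closedness is local confluence.
    module Top (join : JoinClosed) where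
      IsMaximal : Carrier → Set
      IsMaximal v = Region v × ∀ i → len v < len (s i ∙ v) → ¬ Region (s i ∙ v)

      m : Carrier
      m = proj₁ longest

      -- The recursions below carry a bound `n` on the height left under the longest element; each
      -- upward step uses up one unit.
      fuel : ∀ {n u i} → len m ≤ sucℕ n + len u → len u < len (s i ∙ u) → len m ≤ n + len (s i ∙ u)
      fuel {n} {u} {i} le lt = ℕ.≤-trans le (ℕ.≤-trans (ℕ.≤-reflexive (≡.sym (ℕ.+-suc n (len u)))) (ℕ.+-monoʳ-≤ n lt))

      climb : ∀ n u → len m ≤ n + len u → Region u → ∃[ v ] (IsMaximal v × u ≼ v)
      climb n u le y with Fin.any? (λ i → (len u ℕ.<? len (s i ∙ u)) ×-dec Region? (s i ∙ u))
      ... | no none = u , (y , λ i lt y′ → none (i , lt , y′)) , ≼-reflexive ≈-refl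
      climb zero u le y | yes (i , lt , y′) = contradiction (ℕ.<-≤-trans lt (ℕ.≤-trans (proj₂ longest _) le)) (ℕ.<-irrefl refl)
      climb (sucℕ n) u le y | yes (i , lt , y′) with climb n (s i ∙ u) (fuel {i = i} le lt) y′
      ... | v , max , su≼v = v , max , ≼-trans (≼-step lt) su≼v

      maximal-above : ∀ {u v} → IsMaximal u → Region v → u ≼ v → u ≈ v
      maximal-above {u} {v} (yu , max) yv u≼v with u ≟ v
      ... | yes e = e
      ... | no ne with firstStep u≼v ne
      ... | i , lt , su≼v = contradiction (Region-convex (≼-step lt) su≼v yu yv) (max i lt)

      IsMaximal-cong : ∀ {u v} → u ≈ v → IsMaximal u → IsMaximal v
      IsMaximal-cong e (y , max) = Region-cong e y , λ i lt y′ → max i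
        (≡.subst₂ _<_ (len-cong (≈-sym e)) (len-cong (∙-congˡ (≈-sym e))) lt) (Region-cong (∙-congˡ (≈-sym e)) y′)

      -- The first steps towards `v` and `w` have the common upper bound `b ∙ u` in the region.
      -- Climb from it to a maximal `x`, then compare `x` with `v` above `s i ∙ u` and with `w`
      -- above `s j ∙ u`.
      unique : ∀ n u → len m ≤ n + len u → Region u →
        ∀ {v w} → IsMaximal v → IsMaximal w → u ≼ v → u ≼ w → v ≈ w
      unique n u le y {v} {w} Mv Mw u≼v u≼w with u ≟ v
      ... | yes e = ≈-trans (≈-sym e) (maximal-above (IsMaximal-cong (≈-sym e) Mv) (proj₁ Mw) u≼w)
      ... | no u≉v with u ≟ w
      ... | yes e = ≈-trans (≈-sym (maximal-above (IsMaximal-cong (≈-sym e) Mw) (proj₁ Mv) u≼v)) e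
      ... | no u≉w with firstStep u≼v u≉v | firstStep u≼w u≉w
      unique zero u le y Mv Mw u≼v u≼w | no u≉v | no u≉w | i , lti , su≼v | j , ltj , su≼w =
        contradiction (ℕ.<-≤-trans lti (ℕ.≤-trans (proj₂ longest _) le)) (ℕ.<-irrefl refl)
      unique (sucℕ n) u le y {v} {w} Mv Mw u≼v u≼w | no u≉v | no u≉w | i , lti , su≼v | j , ltj , su≼w
        with longestPart {P = λ k → k ≡ i ⊎ k ≡ j} (proj₂ longest) (λ k → (k Fin.≟ i) ⊎-dec (k Fin.≟ j))
      ... | z , b , min , pb , e , Nb = via (climb n (b ∙ u) (ℕ.≤-trans le (ℕ.≤-trans (ℕ.≤-reflexive (≡.sym (ℕ.+-suc n (len u)))) (ℕ.+-monoʳ-≤ n (ℕ.<-≤-trans lti (≼-len (below i (inj₁ refl))))))) (join u i j y yi yj lti ltj b pb))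
        where
        yi : Region (s i ∙ u)
        yi = Region-convex (≼-step lti) su≼v y (proj₁ Mv)
        yj : Region (s j ∙ u)
        yj = Region-convex (≼-step ltj) su≼w y (proj₁ Mw)
        asc : ∀ k → k ≡ i ⊎ k ≡ j → len u < len (s k ∙ u)
        asc k (inj₁ refl) = lti
        asc k (inj₂ refl) = ltj
        ≼-len : ∀ {x y} → x ≼ y → len x ≤ len y
        ≼-len (g , _ , le) = ℕ.≤-trans (ℕ.m≤n+m _ (len g)) le
        below : ∀ k → k ≡ i ⊎ k ≡ j → s k ∙ u ≼ b ∙ u
        below k pk = b ∙ s k , solve (b ∷ u ∷ []) (S k ∷ []) (x₀ ⊙ x₁) (x₀ ⊙ τ₀ ⊙ (τ₀ ⊙ x₁)) refl , (begin
          len (b ∙ s k) + len (s k ∙ u)    ≤⟨ ℕ.+-monoʳ-≤ (len (b ∙ s k)) (len-sˡ-≤ k u) ⟩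
          len (b ∙ s k) + sucℕ (len u)     ≡⟨ ℕ.+-suc _ _ ⟩
          sucℕ (len (b ∙ s k)) + len u     ≡⟨ cong (_+ len u) (N-s-true (Nb (s k) (Refl-s k) (Par-s pk))) ⟩
          len b + len u                    ≡⟨ len-Minimalˡ asc pb ⟨
          len (b ∙ u)                      ∎)
        via : ∃[ x ] (IsMaximal x × b ∙ u ≼ x) → v ≈ w
        via (x , Mx , bu≼x) = ≈-trans
          (unique n (s i ∙ u) (fuel {i = i} le lti) yi Mv Mx su≼v (≼-trans (below i (inj₁ refl)) bu≼x))
          (unique n (s j ∙ u) (fuel {i = j} le ltj) yj Mx Mw (≼-trans (below j (inj₂ refl)) bu≼x) su≼w)

      module _ {u₀ : Carrier} (y₀ : Region u₀) where
        top : ∃[ v ] (IsMaximal v × u₀ ≼ v)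
        top = climb (len m) u₀ (ℕ.m≤m+n _ _) y₀

        -- Induction along a geodesic from `u₀` to `v`, which stays in the region by
        -- `Region-geodesic`.
        below-top : ∀ n v g → len g ≡ n → v ≈ g ∙ u₀ → Region v → v ≼ proj₁ top
        below-top n v g eq e y with g ≟ ε
        ... | yes g≈ε = ≼-trans (≼-reflexive (≈-trans e (≈-trans (∙-congʳ g≈ε) (identityˡ u₀)))) (proj₂ (proj₂ top))
        ... | no g≉ε with leftDescent g≉ε
        below-top zero v g eq e y | no g≉ε | i , l = contradiction (≡.trans l eq) λ ()
        below-top (sucℕ n) v g eq e y | no g≉ε | i , l = by-cases (N v (conj (v ⁻¹) (s i))) refl
          where
          v′ : Carrier
          v′ = s i ∙ g ∙ u₀
          v≈ : v ≈ s i ∙ v′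
          v≈ = ≈-trans e (solve (g ∷ u₀ ∷ []) (S i ∷ []) (x₀ ⊙ x₁) (τ₀ ⊙ (τ₀ ⊙ x₀ ⊙ x₁)) refl)
          v′≈ : v′ ≈ s i ∙ v
          v′≈ = ≈-trans (assoc (s i) g u₀) (∙-congˡ (≈-sym e))
          y′ : Region v′
          y′ = Region-geodesic y₀ y e (s i , solve (g ∷ []) (S i ∷ []) x₀ (τ₀ ⊙ (τ₀ ⊙ x₀)) refl ,
            ℕ.≤-reflexive (≡.trans (cong (_+ len (s i ∙ g)) (len-s i)) l))
          ih : v′ ≼ proj₁ top
          ih = below-top n v′ (s i ∙ g) (ℕ.suc-injective (≡.trans l eq)) ≈-refl y′
          vt : v ∙ conj (v ⁻¹) (s i) ≈ v′
          vt = ≈-trans (solve (v ∷ []) (S i ∷ []) (x₀ ⊙ (x₀ ⁻ ⊙ τ₀ ⊙ x₀ ⁻ ⁻)) (τ₀ ⊙ x₀) refl) (≈-sym v′≈)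
          by-cases : ∀ b → N v (conj (v ⁻¹) (s i)) ≡ b → v ≼ proj₁ top
          by-cases false eq = ≼-trans (≼-trans (≼-step {i} (ℕ.<-≤-trans
              (N-false (Refl-conj (v ⁻¹) (Refl-s i)) eq) (ℕ.≤-reflexive (len-cong (≈-trans vt v′≈))))) (≼-reflexive (≈-sym v′≈))) ih
          -- Here `v` lies above `v′`. A maximal element over `v` and the top are both above `v′`,
          -- so they coincide.
          by-cases true eq with climb (len m) v (ℕ.m≤m+n _ _) y
          ... | x , Mx , v≼x = ≼-trans v≼x (≼-reflexive
            (unique (len m) v′ (ℕ.m≤m+n _ _) y′ Mx (proj₁ (proj₂ top)) (≼-trans v′≼v v≼x) ih))
            where
            v′≼v : v′ ≼ v
            v′≼v = ≼-trans (≼-step {i} (ℕ.<-≤-trans (ℕ.≤-<-trans (ℕ.≤-reflexive (len-cong (≈-sym vt))) (N-true eq)) (ℕ.≤-reflexive (len-cong v≈)))) (≼-reflexive (≈-sym v≈))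

        maximum : ∃[ v ] (Region v × ∀ u → Region u → u ≼ v)
        maximum = proj₁ top , proj₁ (proj₁ (proj₂ top)) , λ u y →
          below-top _ u (u ∙ u₀ ⁻¹) refl (solve (u ∷ u₀ ∷ []) [] x₀ (x₀ ⊙ x₁ ⁻ ⊙ x₁) refl) y

-- Independence of reflections in general position.

module Independence {a ℓ : Level} (W : Group a ℓ) {r : ℕ} (s : Fin r → Group.Carrier W)
  (M : CoxeterMatrix r) (cox : IsCoxeterSystem W s M) (fin : IsFinite W s) where
  open Group W renaming (refl to ≈-refl; sym to ≈-sym; trans to ≈-trans)
  open GroupSolver W using (solve; x₀; x₁; x₂; x₃; τ₀; _⊙_; _⁻; ι)
  open WordProblem W s M cox
  open Inversions W s M cox fin
  open Length W s M cox fin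
  open Parabolic W s M cox fin
  open WeakOrder W s M cox fin
  open Relation.Binary.Reasoning.Setoid setoid

  Refl-≉ε : ∀ {t} → Refl t → ¬ t ≈ ε
  Refl-≉ε {t} R e = contradiction (≡.trans (≡.sym (N-self R)) (≡.trans (N-congˡ t e) (N-ε t))) λ ()

  Par-simple : ∀ {P : Fin r → Set} {t} → Par P t → ¬ t ≈ ε → len t ≤ 1 → ∃[ k ] (P k × t ≈ s k)
  Par-simple p ne le with Par-reduced p
  ... | [] , _ , e , _ = contradiction (≈-sym e) ne
  ... | k ∷ [] , _ , e , pk ∷ [] = k , pk , ≈-trans (≈-sym e) (identityʳ (s k))
  ... | _ ∷ _ ∷ _ , l , _ , _ = contradiction (ℕ.≤-trans (ℕ.≤-reflexive l) le) λ { (s≤s ()) }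

  Par-conj-map : ∀ {P Q : Fin r → Set} y → (∀ k → P k → Par Q (conj y (s k))) →
    ∀ {w} → Par P w → Par Q (conj y w)
  Par-conj-map {P} {Q} y f (ws , ps , e) = Par-cong (conj-cong ≈-refl e) (go ws ps)
    where
    go : ∀ ws → All P ws → Par Q (conj y (eval ws))
    go [] [] = Par-cong (solve (y ∷ []) [] ι (x₀ ⊙ ι ⊙ x₀ ⁻) refl) Par-ε
    go (k ∷ ws) (pk ∷ ps) = Par-cong
      (solve (y ∷ s k ∷ eval ws ∷ []) [] (x₀ ⊙ x₁ ⊙ x₀ ⁻ ⊙ (x₀ ⊙ x₂ ⊙ x₀ ⁻)) (x₀ ⊙ (x₁ ⊙ x₂) ⊙ x₀ ⁻) refl)
      (Par-∙ (f k pk) (go ws ps))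

  Image : ∀ {d} → (Fin d → Fin r) → Fin r → Set
  Image J k = ∃[ a ] J a ≡ k

  Image? : ∀ {d} (J : Fin d → Fin r) k → Dec (Image J k)
  Image? J k = Fin.any? λ a → J a Fin.≟ k

  cons : ∀ {d} → Fin r → (Fin d → Fin r) → Fin (sucℕ d) → Fin r
  cons i J fzero = i
  cons i J (fsuc a) = J a

  -- Adjoining a reflection t raises the rank of a parabolic subgroup by at most one: walk
  -- along q, through elements conjugating J to simple reflections, until t is inverted.
  opaque
    adjoin : ∀ n {d} (J : Fin d → Fin r) q t → len q ≤ n →
      (∀ a → ∃[ k ] conj q (s (J a)) ≈ s k) → Minimal (Image J) q → Refl t → N q t ≡ true →
      ∃[ x ] Σ[ K ∈ (Fin (sucℕ d) → Fin r) ]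
        ((∀ a → Par (Image K) (conj x (s (J a)))) × Par (Image K) (conj x t))
    adjoin n {d} J q t le simple min R Nt with Fin.any? (λ i → N q (s i) Bool.≟ true)
    -- Without right descents `q` inverts no reflection, although it inverts `t`.
    ... | no none = contradiction (≡.trans (≡.sym Nt) (Minimal⇒NoInversion {P = λ _ → ⊤}
            (λ k _ → Bool.¬-not (λ d → none (k , d))) t R (Par-all t))) λ ()
    -- Split off the part `b` of `q` in the subgroup of `i` and `J`. Either `b` inverts `t`, which
    -- then lies in that subgroup, or the walk goes on with the shorter `a`.
    ... | yes (i , Ni) with decompose (Image? (cons i J)) q
    ... | a , b , mina , pb , e with N b t in Nb
    ... | true = ε , cons i J , (λ j → Par-cong (≈-sym (conj-ε _)) (Par-s (fsuc j , refl)))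
            , Par-cong (≈-sym (conj-ε t)) (Par-inversion pb Nb)
    adjoin zero {d} J q t le simple min R Nt | yes (i , Ni) | a , b , mina , pb , e | false =
      contradiction (ℕ.≤-trans (ℕ.≤-reflexive (N-s-true Ni)) le) λ ()
    adjoin (sucℕ n) {d} J q t le simple min R Nt | yes (i , Ni) | a , b , mina , pb , e | false =
      let x , K , pJ , pt = adjoin n J′ a (conj b t) shorter simple′ (λ k p → mina k (J′-in p)) (Refl-conj b R) Nt′
      in x ∙ b , K
         , (λ j → Par-cong (≈-trans (conj-cong ≈-refl (≈-sym (proj₂ (proj₂ (moved j))))) (≈-sym (conj-∙ x b _))) (pJ j))
         , Par-cong (≈-sym (conj-∙ x b t)) pt
      where
      P : Fin r → Set
      P = Image (cons i J)
      Nt′ : N a (conj b t) ≡ true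
      Nt′ = ≡.trans (cong (_xor N a (conj b t)) (≡.sym Nb))
        (≡.trans (≡.sym (N-∙ a b t)) (≡.trans (N-congˡ t (≈-sym e)) Nt))
      len-q : len q ≡ len a + len b
      len-q = ≡.trans (len-cong e) (len-Minimal mina pb)
      shorter : len a ≤ n
      shorter with len b in lb
      ... | zero = contradiction
        (≡.trans (≡.sym Ni) (≡.trans (N-congˡ (s i) (≈-trans e (≈-trans (∙-congˡ (len≡0 lb)) (identityʳ a)))) (mina i (fzero , refl)))) λ ()
      ... | sucℕ l = s≤s⁻¹ (ℕ.≤-trans (s≤s (ℕ.m≤m+n (len a) l))
        (ℕ.≤-trans (ℕ.≤-reflexive (≡.trans (≡.sym (ℕ.+-suc (len a) l)) (≡.trans (cong (len a +_) (≡.sym lb)) (≡.sym len-q)))) le))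
      -- `a ∙ conj b (s (J j))` equals a simple reflection times `a`, so its length is at most
      -- `len a + 1`; as lengths add, `conj b (s (J j))` is simple.
      moved : ∀ j → ∃[ k ] (P k × conj b (s (J j)) ≈ s k)
      moved j = Par-simple (Par-conj pb (Par-s (fsuc j , refl))) (Refl-≉ε (Refl-conj b (Refl-s (J j))))
        (ℕ.+-cancelˡ-≤ (len a) _ _ (ℕ.≤-trans
          (ℕ.≤-reflexive (≡.trans (≡.sym (len-Minimal mina (Par-conj pb (Par-s (fsuc j , refl)))))
            (len-cong (begin
              a ∙ conj b (s (J j))          ≈⟨ solve (a ∷ b ∷ s (J j) ∷ []) [] (x₀ ⊙ (x₁ ⊙ x₂ ⊙ x₁ ⁻)) (x₀ ⊙ x₁ ⊙ x₂ ⊙ (x₀ ⊙ x₁) ⁻ ⊙ x₀) refl ⟩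
              conj (a ∙ b) (s (J j)) ∙ a    ≈⟨ ∙-congʳ (conj-cong (≈-sym e) ≈-refl) ⟩
              conj q (s (J j)) ∙ a          ≈⟨ ∙-congʳ (proj₂ (simple j)) ⟩
              s (proj₁ (simple j)) ∙ a      ∎))))
          (ℕ.≤-trans (len-sˡ-≤ _ a) (ℕ.≤-reflexive (ℕ.+-comm 1 (len a))))))
      J′ : Fin d → Fin r
      J′ j = proj₁ (moved j)
      J′-in : ∀ {k} → Image J′ k → P k
      J′-in (j , refl) = proj₁ (proj₂ (moved j))
      simple′ : ∀ j → ∃[ k ] conj a (s (J′ j)) ≈ s k
      simple′ j = proj₁ (simple j) , (begin
        conj a (s (J′ j))             ≈⟨ conj-cong ≈-refl (proj₂ (proj₂ (moved j))) ⟨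
        conj a (conj b (s (J j)))     ≈⟨ conj-∙ a b _ ⟨
        conj (a ∙ b) (s (J j))        ≈⟨ conj-cong e ≈-refl ⟨
        conj q (s (J j))              ≈⟨ proj₂ (simple j) ⟩
        s (proj₁ (simple j))          ∎)

  -- The witness z is w₀ w₀(J).
  opaque
    complement : ∀ {d} (J : Fin d → Fin r) → ∃[ z ] (Minimal (Image J) z
      × (∀ a → ∃[ k ] conj z (s (J a)) ≈ s k)
      × (∀ t → Refl t → N z t ≡ true ⊎ Par (Image J) t))
    complement J with longest
    ... | m , L with longestPart L (Image? J)
    ... | z , b , min , pb , e , _ = z , min , simple , outside
      where
      -- `z ∙ b` is `m` and inverts everything, so either `b` inverts `conj (b ⁻¹) t` or `z` inverts
      -- `t`.
      outside : ∀ t → Refl t → N z t ≡ true ⊎ Par (Image J) t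
      outside t R with N b (conj (b ⁻¹) t) in Nb
      ... | true = inj₂ (Par-unconj (Par-⁻¹ pb) (Par-inversion pb Nb))
      ... | false = inj₁ (≡.trans (N-congʳ z (≈-sym (conj-conj⁻¹ b t)))
        (≡.trans (cong (_xor N z (conj b (conj (b ⁻¹) t))) (≡.sym Nb))
        (≡.trans (≡.sym (N-∙ z b (conj (b ⁻¹) t)))
        (≡.trans (N-congˡ _ (≈-sym e)) (longest-N L (Refl-conj (b ⁻¹) R))))))
      simple : ∀ j → ∃[ k ] conj z (s (J j)) ≈ s k
      simple j = let k , _ , q = Par-simple (Par-all t) (Refl-≉ε (Refl-conj z (Refl-s (J j)))) short in k , q
        where
        i : Fin r
        i = J j
        t : Carrier
        t = conj z (s i)
        tm : t ∙ m ≈ z ∙ (s i ∙ b)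
        tm = ≈-trans (∙-congˡ e) (solve (z ∷ b ∷ s i ∷ []) [] (x₀ ⊙ x₂ ⊙ x₀ ⁻ ⊙ (x₀ ⊙ x₁)) (x₀ ⊙ (x₂ ⊙ x₁)) refl)
        len-tm : len (t ∙ m) ≡ len z + len (s i ∙ b)
        len-tm = ≡.trans (len-cong tm) (len-Minimal min (Par-∙ (Par-s (j , refl)) pb))
        len-b : len b ≤ sucℕ (len (s i ∙ b))
        len-b = ℕ.≤-trans (ℕ.≤-reflexive (len-cong (solve (b ∷ []) (S i ∷ []) x₀ (τ₀ ⊙ (τ₀ ⊙ x₀)) refl))) (len-sˡ-≤ i (s i ∙ b))
        -- Left multiplication by `t` shortens `m` by exactly `len t`, but `t ∙ m` is
        -- `z ∙ (s i ∙ b)`, which is at most one shorter than `z ∙ b`.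
        short : len t ≤ 1
        short = ℕ.+-cancelˡ-≤ (len (t ∙ m)) _ _ (ℕ.≤-trans
          (ℕ.≤-reflexive (≡.trans (longest-lenˡ L t) (≡.trans (len-cong e) (len-Minimal min pb))))
          (ℕ.≤-trans (ℕ.+-monoʳ-≤ (len z) len-b)
          (ℕ.≤-reflexive (≡.trans (ℕ.+-suc (len z) _) (≡.trans (cong sucℕ (≡.sym len-tm)) (ℕ.+-comm 1 _))))))

  Realizable : ∀ {k} → (Fin k → Carrier) → Set a
  Realizable {k} ρ = ∀ (sign : Fin k → Bool) → ∃[ u ] ∀ i → N u (ρ i) ≡ sign i

  -- Dropping the minimal factor `a` of `u ∙ x ⁻¹`, or prepending the minimal `z`, keeps the status
  -- of every reflection in the parabolic subgroup, while `z` flips that of `ρ fzero`.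
  realizable-cons : ∀ {k} (ρ : Fin (sucℕ k) → Carrier) → (∀ i → Refl (ρ i)) →
    ∀ {d} (J : Fin d → Fin r) x → (∀ i → Par (Image J) (conj x (ρ (fsuc i)))) →
    ∀ z → Minimal (Image J) z → (∀ t → Refl t → N z t ≡ true ⊎ Par (Image J) t) →
    N z (conj x (ρ fzero)) ≡ true → Realizable (ρ ∘ fsuc) → Realizable ρ
  realizable-cons ρ R J x mem z minz out Nz real sign with real (sign ∘ fsuc)
  ... | u , hu with decompose (Image? J) (u ∙ x ⁻¹)
  ... | a , b , mina , pb , e = by-cases (N v (ρ fzero) Bool.≟ sign fzero)
    where
    v : Carrier
    v = b ∙ x
    agree : ∀ y → Minimal (Image J) y → ∀ i → N (y ∙ v) (ρ (fsuc i)) ≡ N v (ρ (fsuc i))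
    agree y miny i = ≡.trans (N-∙ y v _) (≡.trans (cong (N v (ρ (fsuc i)) xor_)
      (Minimal⇒NoInversion miny _ (Refl-conj v (R (fsuc i)))
        (Par-cong (≈-sym (conj-∙ b x _)) (Par-conj pb (mem i))))) (Bool.xor-identityʳ _))
    hv : ∀ i → N v (ρ (fsuc i)) ≡ sign (fsuc i)
    hv i = ≡.trans (≡.sym (agree a mina i)) (≡.trans (N-congˡ _ (begin
        a ∙ (b ∙ x)        ≈⟨ assoc a b x ⟨
        a ∙ b ∙ x          ≈⟨ ∙-congʳ e ⟨
        u ∙ x ⁻¹ ∙ x       ≈⟨ solve (u ∷ x ∷ []) [] (x₀ ⊙ x₁ ⁻ ⊙ x₁) x₀ refl ⟩
        u                  ∎)) (hu i))
    flipped : N (z ∙ v) (ρ fzero) ≡ not (N v (ρ fzero))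
    flipped = ≡.trans (N-∙ z v _) (≡.trans (cong (N v (ρ fzero) xor_)
      (≡.trans (N-congʳ z (conj-∙ b x _)) true′)) (≡.trans (Bool.xor-comm (N v (ρ fzero)) true) (Bool.true-xor _)))
      where
      Rt : Refl (conj x (ρ fzero))
      Rt = Refl-conj x (R fzero)
      -- Otherwise this conjugate, hence also `conj x (ρ fzero)`, would lie in the parabolic
      -- subgroup, where `z` inverts nothing.
      true′ : N z (conj b (conj x (ρ fzero))) ≡ true
      true′ with out _ (Refl-conj b Rt)
      ... | inj₁ eq = eq
      ... | inj₂ p = contradiction (≡.trans (≡.sym Nz) (Minimal⇒NoInversion minz _ Rt (Par-unconj pb p))) λ ()
    by-cases : Dec (N v (ρ fzero) ≡ sign fzero) → ∃[ u ] ∀ i → N u (ρ i) ≡ sign i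
    by-cases (yes eq) = v , λ { fzero → eq ; (fsuc i) → hv i }
    by-cases (no ne) = z ∙ v , λ { fzero → ≡.trans flipped (≡.sym (Bool.¬-not (ne ∘ ≡.sym)))
                                 ; (fsuc i) → ≡.trans (agree z minz i) (hv i) }

  opaque
    -- Add the reflections one at a time, with a conjugator `x` carrying all of them into a standard
    -- parabolic subgroup. A reflection already inside costs no generator and gives `d < k`; one
    -- outside costs one generator and preserves whichever alternative held before.
    span : ∀ k (ρ : Fin k → Carrier) → (∀ i → Refl (ρ i)) →
      ∃[ d ] Σ[ J ∈ (Fin d → Fin r) ] ∃[ x ]
        (d ≤ k × (∀ i → Par (Image J) (conj x (ρ i))) × (d < k ⊎ Realizable ρ))
    span zero ρ R = 0 , (λ ()) , ε , z≤n , (λ ()) , inj₂ λ _ → ε , λ ()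
    span (sucℕ k) ρ R with span k (ρ ∘ fsuc) (R ∘ fsuc)
    ... | d , J , x , d≤k , mem , alt with complement J
    ... | z , minz , simple , out with out (conj x (ρ fzero)) (Refl-conj x (R fzero))
    ... | inj₂ p = d , J , x , ℕ.m≤n⇒m≤1+n d≤k , (λ { fzero → p ; (fsuc i) → mem i }) , inj₁ (s≤s d≤k)
    ... | inj₁ Nz with adjoin _ J z (conj x (ρ fzero)) ℕ.≤-refl simple minz (Refl-conj x (R fzero)) Nz
    ... | y , K , pJ , pt = sucℕ d , K , y ∙ x , s≤s d≤k
      , (λ { fzero → Par-cong (≈-sym (conj-∙ y x _)) pt
           ; (fsuc i) → Par-cong (≈-sym (conj-∙ y x _)) (Par-conj-map y (λ { k (j , refl) → pJ j }) (mem i)) })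
      , dependent alt
      where
      dependent : d < k ⊎ Realizable (ρ ∘ fsuc) → sucℕ d < sucℕ k ⊎ Realizable ρ
      dependent (inj₁ lt) = inj₁ (s≤s lt)
      dependent (inj₂ real) = inj₂ (realizable-cons ρ R J x mem z minz out Nz real)

  -- A Coxeter element lies in no proper parabolic subgroup.

  pull : ∀ {i ws} → i ∈ ws →
    ∃[ ts ] (All Refl ts × sucℕ (length ts) ≡ length ws × eval ws ≈ s i ∙ prod W s ts)
  pull {i} {_ ∷ ws} (here refl) = map s ws , All.map⁺ (All.universal Refl-s ws) ,
    cong sucℕ (List.length-map s ws) , ≈-refl
  pull {i} {k ∷ ws} (there p) with pull p
  ... | ts , R , l , e = conj (s i) (s k) ∷ ts , Refl-conj (s i) (Refl-s k) ∷ R , cong sucℕ l ,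
    ≈-trans (∙-congˡ e) (solve (prod W s ts ∷ s k ∷ []) (S i ∷ []) (x₁ ⊙ (τ₀ ⊙ x₀)) (τ₀ ⊙ (τ₀ ⊙ x₁ ⊙ τ₀ ⁻ ⊙ x₀)) refl)

  -- `pull` brings the later letter next to the earlier one, turning the letters it passes into
  -- conjugates, and two equal involutions cancel.
  cancel-repeated : ∀ {i j ws} → i ∈ ws → j ∈ ws → i ≢ j → s i ≈ s j →
    ∃[ ts ] (All Refl ts × length ts < length ws × eval ws ≈ prod W s ts)
  cancel-repeated (here refl) (here refl) ne e = contradiction refl ne
  cancel-repeated {i} (here refl) (there q) ne e with pull q
  ... | ts , R , l , e′ = ts , R , ℕ.m≤n⇒m≤1+n (ℕ.≤-reflexive l) , ≈-trans (∙-congˡ (≈-trans e′ (∙-congʳ (≈-sym e))))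
    (solve (prod W s ts ∷ []) (S i ∷ []) (τ₀ ⊙ (τ₀ ⊙ x₀)) x₀ refl)
  cancel-repeated (there p) (here refl) ne e = cancel-repeated (here refl) (there p) (ne ∘ ≡.sym) (≈-sym e)
  cancel-repeated {ws = k ∷ ws} (there p) (there q) ne e with cancel-repeated p q ne e
  ... | ts , R , l , e′ = s k ∷ ts , Refl-s k ∷ R , s≤s l , ∙-congˡ e′

  -- Follow the minimal coset representatives along the word: a letter either moves the
  -- representative or fixes its coset, and the latter contributes a reflection to ts.
  record Walk (P : Fin r → Set) (x : Carrier) (ws : List (Fin r)) : Set (a Level.⊔ ℓ) where
    field
      moves : List (Fin r)
      ts : List Carrier
      b : Carrier
      reflections : All Refl ts
      lengths : length moves + length ts ≡ length ws
      product : eval ws ≈ eval moves ∙ prod W s ts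
      minimal : Minimal P (eval moves ∙ x)
      inside : Par P b
      position : eval ws ∙ x ≈ eval moves ∙ x ∙ b
      fixed : moves ≡ [] → All (λ i → Par P (conj (x ⁻¹) (s i))) ws

  -- Deodhar's lemma: for a minimal representative `y`, either `s i ∙ y` is minimal again, or it
  -- equals `y ∙ s k` with `k` in `P` and the coset is fixed.
  walk : ∀ {P : Fin r → Set} → (∀ k → Dec (P k)) → ∀ {x} → Minimal P x → ∀ ws → Walk P x ws
  walk P? {x} min [] = record
    { moves = [] ; ts = [] ; b = ε ; reflections = [] ; lengths = refl
    ; product = ≈-sym (identityˡ ε)
    ; minimal = λ k pk → ≡.trans (N-congˡ (s k) (identityˡ x)) (min k pk)
    ; inside = Par-ε ; position = ≈-sym (identityʳ _) ; fixed = λ _ → [] }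
  walk {P} P? {x} min (i ∷ ws) with walk P? min ws
  ... | w = by-cases (Fin.any? λ k → P? k ×-dec (N (s i ∙ y) (s k) Bool.≟ true))
    where
    open Walk w
    g y : Carrier
    g = eval moves
    y = g ∙ x
    by-cases : Dec (∃[ k ] (P k × N (s i ∙ y) (s k) ≡ true)) → Walk P x (i ∷ ws)
    by-cases (no none) = record
      { moves = i ∷ moves ; ts = ts ; b = b ; reflections = reflections
      ; lengths = cong sucℕ lengths
      ; product = ≈-trans (∙-congˡ product) (≈-sym (assoc _ _ _))
      ; minimal = λ k pk → ≡.trans (N-congˡ (s k) (assoc (s i) g x)) (Bool.¬-not λ d → none (k , pk , d))
      ; inside = inside
      ; position = ≈-trans (assoc _ _ _) (≈-trans (∙-congˡ position)
          (solve (s i ∷ g ∷ x ∷ b ∷ []) [] (x₀ ⊙ (x₁ ⊙ x₂ ⊙ x₃)) (x₀ ⊙ x₁ ⊙ x₂ ⊙ x₃) refl))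
      ; fixed = λ () }
    by-cases (yes (k , pk , d)) = record
      { moves = moves ; ts = conj (g ⁻¹) (s i) ∷ ts ; b = s k ∙ b
      ; reflections = Refl-conj (g ⁻¹) (Refl-s i) ∷ reflections
      ; lengths = ≡.trans (ℕ.+-suc _ _) (cong sucℕ lengths)
      ; product = ≈-trans (∙-congˡ product)
          (solve (s i ∷ g ∷ prod W s ts ∷ []) [] (x₀ ⊙ (x₁ ⊙ x₂)) (x₁ ⊙ (x₁ ⁻ ⊙ x₀ ⊙ x₁ ⁻ ⁻ ⊙ x₂)) refl)
      ; minimal = minimal
      ; inside = Par-∙ (Par-s pk) inside
      ; position = begin
          s i ∙ eval ws ∙ x          ≈⟨ assoc _ _ _ ⟩
          s i ∙ (eval ws ∙ x)        ≈⟨ ∙-congˡ position ⟩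
          s i ∙ (y ∙ b)              ≈⟨ ∙-congʳ same ⟨
          conj y (s k) ∙ (y ∙ b)     ≈⟨ solve (y ∷ s k ∷ b ∷ []) [] (x₀ ⊙ x₁ ⊙ x₀ ⁻ ⊙ (x₀ ⊙ x₂)) (x₀ ⊙ (x₁ ⊙ x₂)) refl ⟩
          y ∙ (s k ∙ b)              ∎
      ; fixed = λ eq → Par-cong (here-fixed eq) (Par-s pk) ∷ fixed eq }
      where
      -- `s i ∙ y` inverts `s k` and `y` does not, so `s i` inverts `conj y (s k)`; but it inverts
      -- only itself.
      same : conj y (s k) ≈ s i
      same = hit-true _ _ (≡.trans (≡.sym (N-s i _)) (≡.trans (cong (_xor N (s i) (conj y (s k))) (≡.sym (minimal k pk)))
        (≡.trans (≡.sym (N-∙ (s i) y (s k))) d)))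
      here-fixed : moves ≡ [] → s k ≈ conj (x ⁻¹) (s i)
      here-fixed eq = begin
        s k                        ≈⟨ conj⁻¹-conj x (s k) ⟨
        conj (x ⁻¹) (conj x (s k)) ≈⟨ conj-cong ≈-refl (conj-cong (≈-trans (∙-congʳ (reflexive (cong eval eq))) (identityˡ x)) ≈-refl) ⟨
        conj (x ⁻¹) (conj y (s k)) ≈⟨ conj-cong ≈-refl same ⟩
        conj (x ⁻¹) (s i)          ∎

  opaque
    -- Otherwise `c` would fix a left coset of the parabolic subgroup, and the walk along its word
    -- would return to the minimal representative. The moves then multiply to `ε`, and counting
    -- reflections shows that there are none.
    coxeter-elliptic : ∀ {c} → IsStdCoxeterElement W s c →
      (∀ ts → All Refl ts → prod W s ts ≈ c → r ≤ length ts) →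
      ∀ {d} (J : Fin d → Fin r) x → d < r → ¬ Par (Image J) (conj x c)
    coxeter-elliptic {c} (ws , perm , ev) absolute {d} J x′ d<r p with decompose (Image? J) (x′ ⁻¹)
    ... | x , b₀ , min , pb₀ , e with walk (Image? J) min ws
    ... | w = clash (Fin.pigeonhole d<r letter)
      where
      open Walk w
      length-ws : length ws ≡ r
      length-ws = ≡.trans (↭.↭-length perm) (List.length-tabulate _)
      mem : ∀ i → i ∈ ws
      mem i = ↭.∈-resp-↭ (↭.↭-sym perm) (∈-allFin i)
      p₁ : Par (Image J) (conj (x ⁻¹) c)
      p₁ = Par-cong (begin
        conj b₀ (conj x′ c)     ≈⟨ conj-∙ b₀ x′ c ⟨
        conj (b₀ ∙ x′) c        ≈⟨ conj-cong (solve (b₀ ∷ x′ ∷ []) [] (x₀ ⊙ x₁) ((x₁ ⁻ ⊙ x₀ ⁻) ⁻) refl) ≈-refl ⟩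
        conj ((x′ ⁻¹ ∙ b₀ ⁻¹) ⁻¹) c ≈⟨ conj-cong (⁻¹-cong (≈-trans (∙-congʳ e) (solve (x ∷ b₀ ∷ []) [] (x₀ ⊙ x₁ ⊙ x₁ ⁻) x₀ refl))) ≈-refl ⟩
        conj (x ⁻¹) c           ∎) (Par-conj pb₀ p)
      returns : eval moves ∙ x ≈ x
      returns = Minimal-unique min minimal (Par-∙ p₁ (Par-⁻¹ inside)) (begin
        eval moves ∙ x                      ≈⟨ solve (eval moves ∷ x ∷ b ∷ []) [] (x₀ ⊙ x₁) (x₀ ⊙ x₁ ⊙ x₂ ⊙ x₂ ⁻) refl ⟩
        eval moves ∙ x ∙ b ∙ b ⁻¹           ≈⟨ ∙-congʳ position ⟨
        eval ws ∙ x ∙ b ⁻¹                  ≈⟨ ∙-congʳ (∙-congʳ ev) ⟩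
        c ∙ x ∙ b ⁻¹                        ≈⟨ solve (c ∷ x ∷ b ∷ []) [] (x₀ ⊙ x₁ ⊙ x₂ ⁻) (x₁ ⊙ (x₁ ⁻ ⊙ x₀ ⊙ x₁ ⁻ ⁻ ⊙ x₂ ⁻)) refl ⟩
        x ∙ (conj (x ⁻¹) c ∙ b ⁻¹)          ∎)
      moves≈ε : eval moves ≈ ε
      moves≈ε = begin
        eval moves              ≈⟨ solve (eval moves ∷ x ∷ []) [] x₀ (x₀ ⊙ x₁ ⊙ x₁ ⁻) refl ⟩
        eval moves ∙ x ∙ x ⁻¹   ≈⟨ ∙-congʳ returns ⟩
        x ∙ x ⁻¹                ≈⟨ inverseʳ x ⟩
        ε                       ∎
      r≤ts : r ≤ length ts
      r≤ts = absolute ts reflections (begin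
        prod W s ts               ≈⟨ identityˡ _ ⟨
        ε ∙ prod W s ts           ≈⟨ ∙-congʳ moves≈ε ⟨
        eval moves ∙ prod W s ts  ≈⟨ product ⟨
        eval ws                   ≈⟨ ev ⟩
        c                         ∎)
      no-moves : moves ≡ []
      no-moves with moves | lengths
      ... | [] | _ = refl
      ... | k ∷ ks | l = contradiction (ℕ.≤-trans (s≤s (ℕ.≤-trans r≤ts (ℕ.m≤n+m _ (length ks))))
        (ℕ.≤-reflexive (≡.trans l length-ws))) (ℕ.<-irrefl refl)
      -- With no moves every letter fixes the coset, and the letters are all the simple reflections.
      everything : ∀ v → Par (Image J) (conj (x ⁻¹) v)
      everything v = Par-conj-map {P = λ _ → ⊤} (x ⁻¹) (λ i _ → All.lookup (fixed no-moves) (mem i)) (Par-all v)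
      simple : ∀ i → ∃[ k ] (Image J k × s i ≈ s k)
      simple i = Par-simple (Par-cong (conj⁻¹-conj x (s i)) (everything (conj x (s i)))) (Refl-≉ε (Refl-s i)) (len-s-≤ i)
      letter : Fin r → Fin d
      letter i = proj₁ (proj₁ (proj₂ (simple i)))
      -- As `d < r`, two simple reflections coincide; cancelling them writes `c` with fewer than `r`
      -- reflections.
      clash : ¬ (∃[ i ] ∃[ j ] (i Fin.< j × letter i ≡ letter j))
      clash (i , j , lt , eq) = let ts′ , R , l , e′ = cancel-repeated (mem i) (mem j) (Fin.<⇒≢ lt) si≈sj in
        ℕ.<⇒≱ l (ℕ.≤-trans (ℕ.≤-reflexive length-ws) (absolute ts′ R (≈-trans (≈-sym e′) ev)))
        where
        si≈sj : s i ≈ s j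
        si≈sj = ≈-trans (proj₂ (proj₂ (simple i))) (≈-trans
          (reflexive (cong s (≡.trans (≡.sym (proj₂ (proj₁ (proj₂ (simple i)))))
            (≡.trans (cong J eq) (proj₂ (proj₁ (proj₂ (simple j)))))))) (≈-sym (proj₂ (proj₂ (simple j)))))

-- `n` strict steps rising by at most `n` in total rise by one each: count up from the first index
-- and down from the last.
strictly-increasing : ∀ {n} (f : Fin (sucℕ n) → ℕ) → (∀ i → f (inject₁ i) < f (fsuc i)) →
  f (fromℕ n) ≤ f fzero + n → ∀ i → f i ≡ f fzero + toℕ i
strictly-increasing {n} f inc bound i = ℕ.≤-antisym upper (ascend i)
  where
  open ℕ.≤-Reasoning
  ascend : ∀ i → f fzero + toℕ i ≤ f i
  ascend = <-weakInduction (λ i → f fzero + toℕ i ≤ f i) (ℕ.≤-reflexive (ℕ.+-identityʳ _)) λ i ih → begin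
    f fzero + sucℕ (toℕ i)            ≡⟨ ℕ.+-suc _ _ ⟩
    sucℕ (f fzero + toℕ i)            ≡⟨ cong (λ k → sucℕ (f fzero + k)) (Fin.toℕ-inject₁ i) ⟨
    sucℕ (f fzero + toℕ (inject₁ i))  ≤⟨ s≤s ih ⟩
    sucℕ (f (inject₁ i))              ≤⟨ inc i ⟩
    f (fsuc i)                        ∎
  descend : ∀ i → f i + n ≤ f (fromℕ n) + toℕ i
  descend = >-weakInduction (λ i → f i + n ≤ f (fromℕ n) + toℕ i)
    (ℕ.≤-reflexive (cong (f (fromℕ n) +_) (≡.sym (Fin.toℕ-fromℕ n)))) λ i ih → s≤s⁻¹ (begin
    sucℕ (f (inject₁ i)) + n                ≤⟨ ℕ.+-monoˡ-≤ n (inc i) ⟩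
    f (fsuc i) + n                          ≤⟨ ih ⟩
    f (fromℕ n) + sucℕ (toℕ i)              ≡⟨ ℕ.+-suc _ _ ⟩
    sucℕ (f (fromℕ n) + toℕ i)              ≡⟨ cong (λ k → sucℕ (f (fromℕ n) + k)) (Fin.toℕ-inject₁ i) ⟨
    sucℕ (f (fromℕ n) + toℕ (inject₁ i))    ∎)
  upper : f i ≤ f fzero + toℕ i
  upper = ℕ.+-cancelʳ-≤ n _ _ (begin
    f i + n                   ≤⟨ descend i ⟩
    f (fromℕ n) + toℕ i       ≤⟨ ℕ.+-monoˡ-≤ (toℕ i) bound ⟩
    f fzero + n + toℕ i       ≡⟨ ℕ.+-assoc (f fzero) n (toℕ i) ⟩
    f fzero + (n + toℕ i)     ≡⟨ cong (f fzero +_) (ℕ.+-comm n (toℕ i)) ⟩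
    f fzero + (toℕ i + n)     ≡⟨ ℕ.+-assoc (f fzero) (toℕ i) n ⟨
    f fzero + toℕ i + n       ∎)

-- Concordance with a maximal chain as a sign region.

module Concordance {a ℓ : Level} (W : Group a ℓ) {r : ℕ} (s : Fin r → Group.Carrier W)
  (M : CoxeterMatrix r) (cox : IsCoxeterSystem W s M) (fin : IsFinite W s)
  (c : Group.Carrier W) (std : IsStdCoxeterElement W s c)
  (π : Fin (sucℕ r) → Group.Carrier W) (chain : IsMaxChain W s c π) where
  open Group W renaming (refl to ≈-refl; sym to ≈-sym; trans to ≈-trans)
  open GroupSolver W using (solve; x₀; x₁; x₂; _⊙_; _⁻; ι)
  open WordProblem W s M cox
  open Inversions W s M cox fin
  open Length W s M cox fin
  open Parabolic W s M cox fin
  open WeakOrder W s M cox fin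
  open Independence W s M cox fin
  open ℕ.≤-Reasoning

  ≤L⇒≼ : ∀ {u v} → _≤L_ W s u v → u ≼ v
  ≤L⇒≼ {u} {v} (as , bs , red , red′ , e , e′) = eval as ,
    ≈-trans (≈-sym e′) (≈-trans (eval-++ as bs) (∙-congˡ e)) , (begin
      len (eval as) + len u     ≤⟨ ℕ.+-mono-≤ (len-≤ as ≈-refl) (len-≤ bs e) ⟩
      length as + length bs     ≡⟨ List.length-++ as ⟨
      length (as ++ bs)         ≡⟨ HasLenS⇒len red′ ⟨
      len (eval (as ++ bs))     ≡⟨ len-cong e′ ⟩
      len v                     ∎)

  ≼⇒≤L : ∀ {u v} → u ≼ v → _≤L_ W s u v
  ≼⇒≤L {u} {v} (w , e , le) with shortest w | shortest u
  ... | as , la , ea | bs , lb , eb = as , bs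
    , len⇒HasLenS (≡.trans (len-cong eb) (≡.sym lb))
    , len⇒HasLenS (≡.trans (len-cong whole) (≡.trans (≡.trans (len-cong e)
        (ℕ.≤-antisym (len-∙ w u) (ℕ.≤-trans le (ℕ.≤-reflexive (len-cong e)))))
        (≡.sym (≡.trans (List.length-++ as) (cong₂ _+_ la lb)))))
    , eb , whole
    where
    whole : eval (as ++ bs) ≈ v
    whole = ≈-trans (eval-++ as bs) (≈-trans (∙-cong ea eb) (≈-sym e))

  ≤B⇒len-≤ : ∀ {u v} → _≤B_ W s u v → len u ≤ len v
  ≤B⇒len-≤ (inj₁ e) = ℕ.≤-reflexive (len-cong e)
  ≤B⇒len-≤ (inj₂ p) = go p
    where
    go : ∀ {u v} → Plus (BruhatCover W s) u v → len u ≤ len v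
    go [ _ , _ , _ , n , hu , hv ] = ℕ.≤-trans (ℕ.≤-reflexive (HasLenS⇒len hu))
      (ℕ.≤-trans (ℕ.n≤1+n n) (ℕ.≤-reflexive (≡.sym (HasLenS⇒len hv))))
    go (_ ∼⁺⟨ p ⟩ q) = ℕ.≤-trans (go p) (go q)

  HasLenT-unique : ∀ {u n k} → HasLenT W s u n → HasLenT W s u k → n ≡ k
  HasLenT-unique ((ts , R , refl , e) , min) ((ts′ , R′ , refl , e′) , min′) =
    ℕ.≤-antisym (min ts′ R′ e′) (min′ ts R e)

  lenT : ∀ i → ∃[ n ] HasLenT W s (π i) n
  lenT fzero = 0 , ([] , [] , refl , ≈-sym (proj₁ chain)) , λ _ _ _ → z≤n
  lenT (fsuc i) = let (_ , _ , _ , _ , h) , _ = proj₂ (proj₂ chain) i in _ , h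

  length-c : ∃[ ws ] (length ws ≡ r × eval ws ≈ c)
  length-c = let ws , perm , e = std in ws , ≡.trans (↭.↭-length perm) (List.length-tabulate _) , e

  lenT-step : ∀ i → ∃[ b ] (HasLenT W s (π (inject₁ i) ⁻¹ ∙ π (fsuc i)) b
    × proj₁ (lenT (fsuc i)) ≡ proj₁ (lenT (inject₁ i)) + b)
  lenT-step i = let (_ , b , h , h′ , _) , _ = proj₂ (proj₂ chain) i in
    b , h′ , cong (_+ b) (HasLenT-unique h (proj₂ (lenT (inject₁ i))))

  opaque
    -- Absolute lengths strictly increase along the chain, and the word of `c` bounds the last one
    -- by `r`.
    lenT-π : ∀ i → proj₁ (lenT i) ≡ toℕ i
    lenT-π = strictly-increasing (proj₁ ∘ lenT) increasing bound
      where
      increasing : ∀ i → proj₁ (lenT (inject₁ i)) < proj₁ (lenT (fsuc i))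
      increasing i with lenT-step i
      ... | sucℕ b , _ , eq = ℕ.≤-trans (ℕ.m≤m+n _ b) (ℕ.≤-reflexive (≡.trans (≡.sym (ℕ.+-suc _ b)) (≡.sym eq)))
      -- A quotient of absolute length zero would identify two consecutive elements, which a cover
      -- forbids.
      ... | zero , (([] , _ , _ , e) , _) , _ = contradiction
        (≈-trans (≈-trans (≈-sym (identityʳ _)) (∙-congˡ e))
          (solve (π (inject₁ i) ∷ π (fsuc i) ∷ []) [] (x₀ ⊙ (x₀ ⁻ ⊙ x₁)) x₁ refl))
        (proj₁ (proj₂ (proj₂ (proj₂ chain) i)))
      bound : proj₁ (lenT (fromℕ r)) ≤ r
      bound = let ws , l , e = length-c in ℕ.≤-trans
        (proj₂ (proj₂ (lenT (fromℕ r))) (map s ws) (All.map⁺ (All.universal Refl-s ws)) (≈-trans e (≈-sym (proj₁ (proj₂ chain)))))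
        (ℕ.≤-reflexive (≡.trans (List.length-map s ws) l))

  opaque
    absolute-length : ∀ ts → All Refl ts → prod W s ts ≈ c → r ≤ length ts
    absolute-length ts R e = ℕ.≤-trans
      (ℕ.≤-reflexive (≡.trans (≡.sym (Fin.toℕ-fromℕ r)) (≡.sym (lenT-π (fromℕ r)))))
      (proj₂ (proj₂ (lenT (fromℕ r))) ts R (≈-trans e (≈-sym (proj₁ (proj₂ chain)))))

  t : Fin r → Carrier
  t i = π (inject₁ i) ⁻¹ ∙ π (fsuc i)

  opaque
    -- Consecutive absolute lengths differ by one, so the quotient is a product of one reflection.
    Refl-t : ∀ i → Refl (t i)
    Refl-t i with lenT-step i
    ... | b , h , eq with ℕ.+-cancelˡ-≡ (toℕ i) b 1 (≡.trans
            (cong (_+ b) (≡.sym (≡.trans (lenT-π (inject₁ i)) (Fin.toℕ-inject₁ i))))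
            (≡.trans (≡.sym eq) (≡.trans (lenT-π (fsuc i)) (ℕ.+-comm 1 (toℕ i)))))
    Refl-t i | .1 , ((x ∷ [] , R ∷ [] , _ , e) , _) , eq | refl = Refl-cong (≈-trans (≈-sym (identityʳ x)) e) R

  -- The chain step seen from the left: `ρ i ∙ π (inject₁ i)` is `π (fsuc i)`.
  ρ : Fin r → Carrier
  ρ i = conj (π (inject₁ i)) (t i)

  Refl-ρ : ∀ i → Refl (ρ i)
  Refl-ρ i = Refl-conj (π (inject₁ i)) (Refl-t i)

  π-step : ∀ u i → u ∙ π (inject₁ i) ∙ t i ≈ u ∙ π (fsuc i)
  π-step u i = solve (u ∷ π (inject₁ i) ∷ π (fsuc i) ∷ []) [] (x₀ ⊙ x₁ ⊙ (x₁ ⁻ ⊙ x₂)) (x₀ ⊙ x₂) refl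

  π-zero : ∀ u → len (u ∙ π fzero) ≡ len u
  π-zero u = len-cong (≈-trans (∙-congˡ (proj₁ chain)) (identityʳ u))

  -- For `false` the lengths of `u ∙ π i` rise along the chain, for `true` they fall; left
  -- multiplication by the longest element exchanges the two.
  Monotone : Bool → Carrier → Set
  Monotone b u = ∀ i → N (u ∙ π (inject₁ i)) (t i) ≡ b

  -- The cocycle identity moves the condition on `t i` at `u ∙ π (inject₁ i)` to one on `ρ i` at
  -- `u`; the correction term does not involve `u`.
  sign : Bool → Fin r → Bool
  sign b i = N (π (inject₁ i)) (t i) xor b

  module _ (b : Bool) where
    open SignRegion ρ Refl-ρ (sign b) public using (Region)

  xor-transpose : ∀ x {y z} → x xor y ≡ z → y ≡ x xor z
  xor-transpose false eq = eq
  xor-transpose true {false} refl = refl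
  xor-transpose true {true} refl = refl

  Monotone⇒Region : ∀ {b u} → Monotone b u → Region b u
  Monotone⇒Region {b} {u} h i = xor-transpose (N (π (inject₁ i)) (t i))
    (≡.trans (≡.sym (N-∙ u (π (inject₁ i)) (t i))) (h i))

  Region⇒Monotone : ∀ {b u} → Region b u → Monotone b u
  Region⇒Monotone {b} {u} h i = ≡.trans (N-∙ u (π (inject₁ i)) (t i))
    (≡.sym (xor-transpose (N (π (inject₁ i)) (t i)) (≡.sym (h i))))

  opaque
    -- The `r` rises add up to at most the length of `c`, hence to at most `r`, so each is one.
    len-π : ∀ {u} → Monotone false u → ∀ i → len (u ∙ π i) ≡ len u + toℕ i
    len-π {u} h i = ≡.trans (strictly-increasing (λ i → len (u ∙ π i))
      (λ i → ℕ.<-≤-trans (N-false (Refl-t i) (h i)) (ℕ.≤-reflexive (len-cong (π-step u i)))) (begin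
        len (u ∙ π (fromℕ r))       ≤⟨ len-∙ u (π (fromℕ r)) ⟩
        len u + len (π (fromℕ r))   ≤⟨ ℕ.+-monoʳ-≤ (len u) len-c ⟩
        len u + r                   ≡⟨ cong (_+ r) (π-zero u) ⟨
        len (u ∙ π fzero) + r       ∎) i) (cong (_+ toℕ i) (π-zero u))
      where
      len-c : len (π (fromℕ r)) ≤ r
      len-c = let ws , l , e = length-c in
        ℕ.≤-trans (len-≤ ws (≈-trans e (≈-sym (proj₁ (proj₂ chain))))) (ℕ.≤-reflexive l)

  m : Carrier
  m = proj₁ longest

  L : IsLongest m
  L = proj₂ longest

  opaque
    Monotone-longest : ∀ {b u} → Monotone b u → Monotone (not b) (m ∙ u)
    Monotone-longest {b} {u} h i = ≡.trans (N-congˡ (t i) (assoc m u (π (inject₁ i))))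
      (≡.trans (N-∙ m (u ∙ π (inject₁ i)) (t i))
      (≡.trans (cong₂ _xor_ (h i) (longest-N L (Refl-conj _ (Refl-t i)))) (≡.trans (Bool.xor-comm b true) (Bool.true-xor b))))

  len-π-true : ∀ {u} → Monotone true u → ∀ i → len (u ∙ π i) + toℕ i ≡ len u
  len-π-true {u} h i = ℕ.+-cancelˡ-≡ (len (m ∙ u)) _ _ (begin-equality
    len (m ∙ u) + (len (u ∙ π i) + toℕ i)   ≡⟨ cong (len (m ∙ u) +_) (ℕ.+-comm (len (u ∙ π i)) (toℕ i)) ⟩
    len (m ∙ u) + (toℕ i + len (u ∙ π i))   ≡⟨ ℕ.+-assoc (len (m ∙ u)) (toℕ i) _ ⟨
    len (m ∙ u) + toℕ i + len (u ∙ π i)     ≡⟨ cong (_+ len (u ∙ π i)) (len-π (Monotone-longest h) i) ⟨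
    len (m ∙ u ∙ π i) + len (u ∙ π i)       ≡⟨ cong (_+ len (u ∙ π i)) (len-cong (assoc m u (π i))) ⟩
    len (m ∙ (u ∙ π i)) + len (u ∙ π i)     ≡⟨ longest-len L (u ∙ π i) ⟩
    len m                                   ≡⟨ longest-len L u ⟨
    len (m ∙ u) + len u                     ∎)

  -- The difference between `len (u ∙ π i)` and `len u` depends only on `b` and `i`; the equation is
  -- arranged to avoid subtraction.
  balanced : ∀ b {u v} → Monotone b u → Monotone b v → ∀ i → len (u ∙ π i) + len v ≡ len (v ∙ π i) + len u
  balanced false {u} {v} hu hv i = begin-equality
    len (u ∙ π i) + len v       ≡⟨ cong (_+ len v) (len-π hu i) ⟩
    len u + toℕ i + len v       ≡⟨ ℕ.+-comm _ (len v) ⟩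
    len v + (len u + toℕ i)     ≡⟨ cong (len v +_) (ℕ.+-comm (len u) (toℕ i)) ⟩
    len v + (toℕ i + len u)     ≡⟨ ℕ.+-assoc (len v) (toℕ i) (len u) ⟨
    len v + toℕ i + len u       ≡⟨ cong (_+ len u) (len-π hv i) ⟨
    len (v ∙ π i) + len u       ∎
  balanced true {u} {v} hu hv i = begin-equality
    len (u ∙ π i) + len v                     ≡⟨ cong (len (u ∙ π i) +_) (len-π-true hv i) ⟨
    len (u ∙ π i) + (len (v ∙ π i) + toℕ i)   ≡⟨ ℕ.+-assoc (len (u ∙ π i)) _ _ ⟨
    len (u ∙ π i) + len (v ∙ π i) + toℕ i     ≡⟨ cong (_+ toℕ i) (ℕ.+-comm (len (u ∙ π i)) _) ⟩
    len (v ∙ π i) + len (u ∙ π i) + toℕ i     ≡⟨ ℕ.+-assoc (len (v ∙ π i)) _ _ ⟩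
    len (v ∙ π i) + (len (u ∙ π i) + toℕ i)   ≡⟨ cong (len (v ∙ π i) +_) (len-π-true hu i) ⟩
    len (v ∙ π i) + len u                     ∎

  -- For a reflection `z`, `N` records how the two lengths compare, and a common shift by `d`
  -- preserves this.
  N-translate : ∀ {x y z d} → Refl z → len y ≡ d + len x → len (y ∙ z) ≡ d + len (x ∙ z) → N y z ≡ N x z
  N-translate {x} {y} {z} {d} R e e′ with N x z in eq
  ... | false = <⇒N-false (begin
    len y             ≡⟨ e ⟩
    d + len x         ≤⟨ ℕ.+-monoʳ-≤ d (ℕ.<⇒≤ (N-false R eq)) ⟩
    d + len (x ∙ z)   ≡⟨ e′ ⟨
    len (y ∙ z)       ∎)
  ... | true = >⇒N-true R (begin
    len (y ∙ z)       ≡⟨ e′ ⟩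
    d + len (x ∙ z)   ≤⟨ ℕ.+-monoʳ-≤ d (ℕ.<⇒≤ (N-true eq)) ⟩
    d + len x         ≡⟨ e ⟨
    len y             ∎)

  -- By balance, ascents of u inside the region are ascents of every u π_k, so the whole
  -- dihedral group acts on each u π_k with additive lengths.
  opaque
    joinClosed : ∀ b → SignRegion.JoinClosed ρ Refl-ρ (sign b)
    joinClosed b u i j y yi yj lti ltj w pw = Monotone⇒Region λ k →
      ≡.trans (N-translate {x = u ∙ π (inject₁ k)} {d = len w} (Refl-t k) (additive (inject₁ k))
        (≡.trans (len-cong (π-step (w ∙ u) k)) (≡.trans (additive (fsuc k)) (cong (len w +_) (len-cong (≈-sym (π-step u k)))))))
      (mono k)
      where
      mono : Monotone b u
      mono = Region⇒Monotone y
      rise : ∀ {l} → Region b (s l ∙ u) → len u < len (s l ∙ u) → ∀ k → len (u ∙ π k) < len (s l ∙ (u ∙ π k))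
      rise {l} yl lt k = ℕ.+-cancelʳ-< (len u) _ _ (begin-strict
        len (u ∙ π k) + len u             <⟨ ℕ.+-monoʳ-< (len (u ∙ π k)) lt ⟩
        len (u ∙ π k) + len (s l ∙ u)     ≡⟨ balanced b (Region⇒Monotone yl) mono k ⟨
        len (s l ∙ u ∙ π k) + len u       ≡⟨ cong (_+ len u) (len-cong (assoc (s l) u (π k))) ⟩
        len (s l ∙ (u ∙ π k)) + len u     ∎)
      ascents : ∀ k l → l ≡ i ⊎ l ≡ j → len (u ∙ π k) < len (s l ∙ (u ∙ π k))
      ascents k l (inj₁ refl) = rise yi lti k
      ascents k l (inj₂ refl) = rise yj ltj k
      additive : ∀ k → len (w ∙ u ∙ π k) ≡ len w + len (u ∙ π k)
      additive k = ≡.trans (len-cong (assoc w u (π k))) (len-Minimalˡ (ascents k) pw)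

  opaque
    -- If `span` does not realize all sign patterns, one conjugation carries all `ρ i`, and with
    -- them `c`, into a parabolic subgroup with fewer than `r` generators, against
    -- `coxeter-elliptic`.
    nonempty : ∃[ u ] Region false u
    nonempty with span r ρ Refl-ρ
    ... | _ , _ , _ , _ , _ , inj₂ real = real (sign false)
    ... | d , J , x , _ , mem , inj₁ d<r = contradiction
      (Par-cong (conj-cong ≈-refl (proj₁ (proj₂ chain))) (inside (fromℕ r)))
      (coxeter-elliptic std absolute-length J x d<r)
      where
      inside : ∀ i → Par (Image J) (conj x (π i))
      inside = <-weakInduction (λ i → Par (Image J) (conj x (π i)))
        (Par-cong (≈-trans (solve (x ∷ []) [] ι (x₀ ⊙ ι ⊙ x₀ ⁻) refl) (conj-cong ≈-refl (≈-sym (proj₁ chain)))) Par-ε)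
        λ i p → Par-cong (solve (x ∷ π (inject₁ i) ∷ π (fsuc i) ∷ []) []
            (x₀ ⊙ (x₁ ⊙ (x₁ ⁻ ⊙ x₂) ⊙ x₁ ⁻) ⊙ x₀ ⁻ ⊙ (x₀ ⊙ x₁ ⊙ x₀ ⁻)) (x₀ ⊙ x₂ ⊙ x₀ ⁻) refl)
          (Par-∙ (mem i) p)

  opaque
    maximumOf : ∀ b {u} → Region b u → ∃[ v ] (Region b v × ∀ w → Region b w → w ≼ v)
    maximumOf b y = SignRegion.Top.maximum ρ Refl-ρ (sign b) (joinClosed b) y

  -- Left multiplication by the longest element m reverses the weak order.
  opaque
    minimum : ∃[ v ] (Region false v × ∀ w → Region false w → v ≼ w)
    minimum with nonempty
    ... | u₀ , y₀ with maximumOf true (Monotone⇒Region (Monotone-longest (Region⇒Monotone {false} y₀)))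
    ... | v , yv , above = lo , Monotone⇒Region lo-monotone , below
      where
      lo : Carrier
      lo = m ⁻¹ ∙ v
      mlo : m ∙ lo ≈ v
      mlo = solve (m ∷ v ∷ []) [] (x₀ ⊙ (x₀ ⁻ ⊙ x₁)) x₁ refl
      lo-monotone : Monotone false lo
      lo-monotone i = Bool.not-injective (≡.trans (≡.sym (≡.trans (Bool.xor-comm (N (lo ∙ p) (t i)) true) (Bool.true-xor _)))
        (≡.trans (cong (N (lo ∙ p) (t i) xor_) (≡.sym (longest-N L (Refl-conj (lo ∙ p) (Refl-t i)))))
        (≡.trans (≡.sym (N-∙ m (lo ∙ p) (t i)))
        (≡.trans (N-congˡ (t i) (≈-trans (≈-sym (assoc m lo p)) (∙-congʳ mlo))) (Region⇒Monotone yv i)))))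
        where
        p : Carrier
        p = π (inject₁ i)
      below : ∀ w → Region false w → lo ≼ w
      below w yw with above (m ∙ w) (Monotone⇒Region (Monotone-longest (Region⇒Monotone yw)))
      ... | g , e , le = h , w≈ , (begin
          len h + len lo   ≡⟨ cong (_+ len lo) len-h ⟩
          len g + len lo   ≤⟨ ℕ.+-cancelˡ-≤ (len (m ∙ w)) _ _ bound ⟩
          len w            ∎)
        where
        -- `v` is `g ∙ (m ∙ w)`; solving for `w` multiplies `lo` by a conjugate of `g ⁻¹` under the
        -- longest element, and this conjugation preserves length.
        h : Carrier
        h = m ⁻¹ ∙ (g ⁻¹ ∙ m)
        w≈ : w ≈ h ∙ lo
        w≈ = ≈-trans (solve (m ∷ g ∷ w ∷ []) [] x₂ (x₀ ⁻ ⊙ (x₁ ⁻ ⊙ x₀) ⊙ (x₀ ⁻ ⊙ (x₁ ⊙ (x₀ ⊙ x₂)))) refl)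
          (∙-congˡ (∙-congˡ (≈-sym e)))
        len-h : len h ≡ len g
        len-h = ≡.trans (ℕ.+-cancelʳ-≡ (len (g ⁻¹ ∙ m)) _ _ (begin-equality
          len h + len (g ⁻¹ ∙ m)              ≡⟨ longest-len (longest-⁻¹ L) (g ⁻¹ ∙ m) ⟩
          len (m ⁻¹)                          ≡⟨ len-⁻¹ m ⟩
          len m                               ≡⟨ longest-lenˡ L (g ⁻¹) ⟨
          len (g ⁻¹ ∙ m) + len (g ⁻¹)         ≡⟨ ℕ.+-comm (len (g ⁻¹ ∙ m)) _ ⟩
          len (g ⁻¹) + len (g ⁻¹ ∙ m)         ∎)) (len-⁻¹ g)
        bound : len (m ∙ w) + (len g + len lo) ≤ len (m ∙ w) + len w
        bound = begin
          len (m ∙ w) + (len g + len lo)      ≡⟨ ℕ.+-assoc (len (m ∙ w)) _ _ ⟨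
          len (m ∙ w) + len g + len lo        ≡⟨ cong (_+ len lo) (ℕ.+-comm (len (m ∙ w)) (len g)) ⟩
          len g + len (m ∙ w) + len lo        ≤⟨ ℕ.+-monoˡ-≤ (len lo) le ⟩
          len v + len lo                      ≡⟨ cong (_+ len lo) (len-cong mlo) ⟨
          len (m ∙ lo) + len lo               ≡⟨ longest-len L lo ⟩
          len m                               ≡⟨ longest-len L w ⟨
          len (m ∙ w) + len w                 ∎

  -- Elements of a chain step differ by a reflection, so a weak comparison of lengths decides its
  -- status. Conversely, by `len-π` each step raises the length by exactly one, which is a Bruhat
  -- cover, and the whole chain raises it by `r`.
  concordant⇔region : ∀ u → (InWcPlus W s c u × Concordant W s u π) ⇔ Region false u
  concordant⇔region u = mk⇔
    (λ { (_ , conc) → Monotone⇒Region λ i → <⇒N-false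
           (ℕ.≤-trans (≤B⇒len-≤ (conc i)) (ℕ.≤-reflexive (len-cong (≈-sym (π-step u i))))) })
    (λ y → let h = len-π (Region⇒Monotone {false} y) in
      (len u , len⇒HasLenS refl , len⇒HasLenS (≡.trans (len-cong (∙-congˡ (≈-sym (proj₁ (proj₂ chain)))))
        (≡.trans (h (fromℕ r)) (cong (len u +_) (Fin.toℕ-fromℕ r)))))
      , λ i → inj₂ [ t i , Refl-t i , ≈-sym (π-step u i) , len (u ∙ π (inject₁ i)) , len⇒HasLenS refl
        , len⇒HasLenS (≡.trans (h (fsuc i)) (≡.trans (ℕ.+-suc _ _)
            (cong sucℕ (≡.sym (≡.trans (h (inject₁ i)) (cong (len u +_) (Fin.toℕ-inject₁ i))))))) ])

theorem5p10 : {a ℓ : Level} (W : Group a ℓ) (r : ℕ) (s : Fin r → Group.Carrier W)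
    (M : CoxeterMatrix r) → IsCoxeterSystem W s M → IsFinite W s →
    (c : Group.Carrier W) → IsStdCoxeterElement W s c →
    (π : Fin (sucℕ r) → Group.Carrier W) → IsMaxChain W s c π →
    ∃[ ωlo ] ∃[ ωhi ]
    ((∀ u → (InWcPlus W s c u × Concordant W s u π)
    ⇔ (_≤L_ W s ωlo u × _≤L_ W s u ωhi))
    × ∃[ u ] (_≤L_ W s ωlo u × _≤L_ W s u ωhi))
theorem5p10 W r s M cox fin c std π chain =
  let lo , ylo , least = minimum
      u₀ , y₀ = nonempty
      hi , yhi , greatest = maximumOf false y₀
  in lo , hi
     , (λ u → mk⇔
         (λ p → let y = Equivalence.to (concordant⇔region u) p in ≼⇒≤L (least u y) , ≼⇒≤L (greatest u y))
         -- The region is convex, so it contains everything between its extremes.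
         (λ { (p , q) → Equivalence.from (concordant⇔region u)
                (SignRegion.Region-convex ρ Refl-ρ (sign false) (≤L⇒≼ p) (≤L⇒≼ q) ylo yhi) }))
     , u₀ , ≼⇒≤L (least u₀ y₀) , ≼⇒≤L (greatest u₀ y₀)
  where
  open Concordance W s M cox fin c std π chain
  open WeakOrder W s M cox fin
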